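{- For any graph $A$ it holds that $A \triangleright F(1,1)$ if and only if $A \leadsto F(1,1)$.
   Context: A graph has finite vertex and edge sets; every edge is either a normal edge (incident with two distinct vertices, adding 1 to the degree of each), a loop (incident with one vertex, adding 2 to its degree) or a semi-edge (incident with one vertex, adding 1 to its degree). Multiple loops, semi-edges and parallel normal edges are allowed. A graph is simple if it has no loops, no semi-edges and no parallel normal edges. A covering projection from a graph $G$ to a connected graph $H$ is a pair of surjective maps $f_V:V(G)\to V(H)$, $f_E:E(G)\to E(H)$ such that $f_V$ preserves degrees; $f_E$ maps semi-edges onto semi-edges and loops onto loops (normal edges may be mapped onto normal edges, loops or semi-edges); $f_E$ preserves incidence; and $f_E$ is a local bijection between the edge-neighborhood of every vertex and that of its image (so the preimage of a loop at $u$ is a disjoint union of cycles spanning $f_V^{ -1}(u)$, the preimage of a semi-edge at $u$ is a disjoint union of semi-edges and normal edges covering each vertex of $f_V^{ -1}(u)$ exactly once, and the preimage of a normal edge $uv$ is a perfect matching between $f_V^{ -1}(u)$ and $f_V^{ -1}(v)$). $G\longrightarrow H$ means such a projection exists. A semi-covering projection is defined the same way, except that semi-edges may be mapped onto semi-edges or onto loops (loops still map only onto loops, and normal edges onto normal edges, loops or semi-edges); thus the preimage of a loop at $u$ is a disjoint union of cycles and of paths carrying a semi-edge at each end-vertex, spanning $f_V^{ -1}(u)$. $G\leadsto H$ means a semi-covering projection from $G$ to $H$ exists. $A \triangleright B$ means every simple graph covering $A$ also covers $B$. $F(a,b)$ is the one-vertex graph with $a$ semi-edges and $b$ loops. -}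

module Defs where

open import Data.Nat using (ℕ; zero; suc; _+_; _<_)
open import Data.Fin using (Fin; zero; suc; _≟_; splitAt)
open import Data.Bool using (Bool; true; false; if_then_else_)
open import Data.Sum using (_⊎_; inj₁; inj₂)
open import Data.Product using (Σ; ∃; _×_; _,_)
open import Relation.Nullary using (does)
open import Relation.Binary.PropositionalEquality using (_≡_; _≢_)
open import Relation.Binary.Construct.Closure.ReflexiveTransitive using (Star)

sumFin : (n : ℕ) → (Fin n → ℕ) → ℕ
sumFin zero    f = 0
sumFin (suc n) f = f zero + sumFin n (λ i → f (suc i))

data Ends (n : ℕ) : Set where
  nrm : Fin n → Fin n → Ends n   -- normal edge between two (distinct) vertices
  lp  : Fin n → Ends n           -- loop at a vertex
  sm  : Fin n → Ends n           -- semi-edge at a vertex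

record Graph : Set where
  field
    nV   : ℕ
    nE   : ℕ
    ends : Fin nE → Ends nV
    nrm-distinct : ∀ e u v → ends e ≡ nrm u v → u ≢ v
open Graph public

ind : Bool → ℕ → ℕ
ind b k = if b then k else 0

-- Contribution of an edge to the degree of vertex v (number of its edge-ends at v).
mult : {n : ℕ} → Fin n → Ends n → ℕ
mult v (nrm x y) = ind (does (v ≟ x)) 1 + ind (does (v ≟ y)) 1
mult v (lp x)    = ind (does (v ≟ x)) 2
mult v (sm x)    = ind (does (v ≟ x)) 1

deg : (G : Graph) → Fin (nV G) → ℕ
deg G v = sumFin (nE G) (λ e → mult v (ends G e))

Simple : Graph → Set
Simple G =
  (∀ e → ∃ λ x → ∃ λ y → ends G e ≡ nrm x y) ×
  (∀ e e' x y u v → ends G e ≡ nrm x y → ends G e' ≡ nrm u v →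
     ((x ≡ u × y ≡ v) ⊎ (x ≡ v × y ≡ u)) → e ≡ e')

Adj : (G : Graph) → Fin (nV G) → Fin (nV G) → Set
Adj G u v = ∃ λ e → (ends G e ≡ nrm u v) ⊎ (ends G e ≡ nrm v u)

Connected : Graph → Set
Connected G = (0 < nV G) × (∀ u v → Star (Adj G) u v)

-- How an edge of G may be mapped onto an edge of H, given the vertex map fV
-- (type compatibility + incidence preservation).  The Bool index says whether
-- semi-edges may be mapped onto loops (true = semi-covering).
data EdgeMap {n k : ℕ} (fV : Fin n → Fin k) : Bool → Ends n → Ends k → Set where
  nn  : ∀ {b x y u v} → fV x ≡ u → fV y ≡ v → EdgeMap fV b (nrm x y) (nrm u v)
  nn' : ∀ {b x y u v} → fV x ≡ v → fV y ≡ u → EdgeMap fV b (nrm x y) (nrm u v)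
  nl  : ∀ {b x y w} → fV x ≡ w → fV y ≡ w → EdgeMap fV b (nrm x y) (lp w)
  ns  : ∀ {b x y w} → fV x ≡ w → fV y ≡ w → EdgeMap fV b (nrm x y) (sm w)
  ll  : ∀ {b x w} → fV x ≡ w → EdgeMap fV b (lp x) (lp w)
  ss  : ∀ {b x w} → fV x ≡ w → EdgeMap fV b (sm x) (sm w)
  sl  : ∀ {x w} → fV x ≡ w → EdgeMap fV true (sm x) (lp w)

Surjective : {A B : Set} → (A → B) → Set
Surjective {A} {B} f = ∀ (y : B) → ∃ λ (x : A) → f x ≡ y

record IsProjection (b : Bool) (G H : Graph)
         (fV : Fin (nV G) → Fin (nV H)) (fE : Fin (nE G) → Fin (nE H)) : Set where
  field
    surjV   : Surjective fV
    surjE   : Surjective fE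
    degPres : ∀ v → deg G v ≡ deg H (fV v)
    edgeMap : ∀ e → EdgeMap fV b (ends G e) (ends H (fE e))
    -- local bijection on edge-ends: for each vertex v of G and edge h of H,
    -- the edge-ends at v of edges mapped to h are as many as the ends of h at fV v
    local   : ∀ v h → sumFin (nE G) (λ e → ind (does (fE e ≟ h)) (mult v (ends G e)))
                        ≡ mult (fV v) (ends H h)

Projects : Bool → Graph → Graph → Set
Projects b G H = ∃ λ fV → ∃ λ fE → IsProjection b G H fV fE

Covers : Graph → Graph → Set
Covers = Projects false

SemiCovers : Graph → Graph → Set
SemiCovers = Projects true

_▷_ : Graph → Graph → Set
A ▷ B = ∀ (G : Graph) → Simple G → Covers G A → Covers G B

F-ends : (a b : ℕ) → Fin (a + b) → Ends 1
F-ends a b e with splitAt a e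
... | inj₁ _ = sm zero
... | inj₂ _ = lp zero

F : ℕ → ℕ → Graph
F a b = record { nV = 1 ; nE = a + b ; ends = F-ends a b ; nrm-distinct = F-ok }
  where
  F-ok : ∀ e u v → F-ends a b e ≡ nrm u v → u ≢ v
  F-ok e u v eq with splitAt a e
  F-ok e u v () | inj₁ _
  F-ok e u v () | inj₂ _

{-# OPTIONS --safe #-}

-- Semi-coverings onto F(1,1) are, in cubic graphs, perfect matchings in which
-- a vertex may also be matched by one of its semi-edges. Composing coverings
-- gives one direction. For the other, let Â be two copies of A with each
-- semi-edge replaced by an edge between the copies; a perfect matching of Â
-- restricts to such a matching of A. If Â has none, Tutte's theorem gives a
-- set S with more than |S| odd components in Â − S. A suitable simple cover of
-- A then consists of N copies of S and, for each component C, of N pieces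
-- containing N + 1 copies of C and N copies of everything else of Â, and joined
-- to the copies of S only through one copy of C. Since |Â| is even, the pieces
-- of odd components are odd, and there are more than N |S| of these, so this
-- cover has no perfect matching and does not cover F(1,1).
module Submission where

open import Defs
open import Data.Bool using (Bool; true; false; _∧_; _∨_; not; if_then_else_)
open import Data.Bool.Properties using (∨-zeroʳ)
import Data.Bool.Properties as Bool
open import Data.Empty using (⊥)
open import Data.Fin using (Fin; zero; suc; toℕ; _≟_; splitAt; _↑ˡ_; _↑ʳ_; combine; remQuot; quotient; remainder; fromℕ<; finToFun; funToFin)
open import Data.Fin.Properties using (any?; all?; toℕ-injective; toℕ<n; toℕ-fromℕ<; splitAt-↑ˡ; splitAt-↑ʳ; splitAt⁻¹-↑ˡ; splitAt⁻¹-↑ʳ; remQuot-combine; combine-remQuot; combine-injective; finToFun-funToFin)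
open import Data.Maybe using (Maybe; just; nothing)
open import Data.Nat using (ℕ; zero; suc; _+_; _*_; _∸_; _%_; _≤_; _<_; z≤n; s≤s; s≤s⁻¹; pred; _≤?_; _<?_)
open import Data.Nat.DivMod using (m%n<n; m<n⇒m%n≡m; m≤n⇒[n∸m]%m≡n%m; [m+kn]%n≡m%n; %-distribˡ-+; m%n%n≡m%n)
open import Data.Nat.Properties hiding (_≟_)
open import Data.Product using (Σ; ∃; _×_; _,_; proj₁; proj₂)
open import Data.Product.Properties using (,-injective)
open import Data.Sum using (_⊎_; inj₁; inj₂; [_,_]′)
open import Function using (_∘_; id)
open import Function.Bundles using (_⇔_; mk⇔)
open import Relation.Binary.Definitions using (tri<; tri≈; tri>)
open import Relation.Binary.PropositionalEquality using (_≡_; _≢_; refl; sym; trans; cong; cong₂; subst; module ≡-Reasoning)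
open import Relation.Nullary using (Dec; yes; no; does; ¬_; contradiction)
open import Relation.Nullary.Decidable using (does-⇔; dec-true; dec-false; _×-dec_; _⊎-dec_; _→-dec_; ¬?; map′)

-- Why the cover is so uneven: disjoint copies of Â have no perfect matching either, but they keep
-- the loops and parallel edges of Â. Making the cover simple means permuting sheets, and this may
-- fuse the N copies of an odd component into one, too few against N copies of S. A piece therefore
-- takes one copy of C for the parity and fuses it with N further copies only. The edges from these
-- further copies towards S need ends as well, and so N copies of all of Â are added. In Tutte's
-- theorem, connected components give way to the classes of Gallai's lemma (vertices never missed
-- together by an optimal matching): for the counting it is enough that the classes are pairwise
-- non-adjacent and odd.

private variable
  n m k : ℕ

-- Finite sums

[_] : {P : Set} → Dec P → ℕ
[ p? ] = ind (does p?) 1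

# : (Fin n → Bool) → ℕ
# {n} p = sumFin n (λ i → ind (p i) 1)

[]-⇔ : {P Q : Set} (p? : Dec P) (q? : Dec Q) → (P → Q) → (Q → P) → does p? ≡ does q?
[]-⇔ p? q? f g = does-⇔ (mk⇔ f g) p? q?

ind≤ : ∀ b k → ind b k ≤ k
ind≤ true  k = ≤-refl
ind≤ false k = z≤n

ind-+ : ∀ b i j → ind b (i + j) ≡ ind b i + ind b j
ind-+ true  i j = refl
ind-+ false i j = refl

ind-ind : ∀ a b k → ind a (ind b k) ≡ ind (a ∧ b) k
ind-ind true  b k = refl
ind-ind false b k = refl

ind-swap : ∀ a b k → ind a (ind b k) ≡ ind b (ind a k)
ind-swap true  b     k = refl
ind-swap false true  k = refl
ind-swap false false k = refl

sum-cong : ∀ {n f g} → (∀ i → f i ≡ g i) → sumFin n f ≡ sumFin n g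
sum-cong {zero}  h = refl
sum-cong {suc n} h = cong₂ _+_ (h zero) (sum-cong (h ∘ suc))

sum-mono : ∀ {n f g} → (∀ i → f i ≤ g i) → sumFin n f ≤ sumFin n g
sum-mono {zero}  h = z≤n
sum-mono {suc n} h = +-mono-≤ (h zero) (sum-mono (h ∘ suc))

sum-zero : ∀ n → sumFin n (λ _ → 0) ≡ 0
sum-zero zero    = refl
sum-zero (suc n) = sum-zero n

sum-const : ∀ n c → sumFin n (λ _ → c) ≡ n * c
sum-const zero    c = refl
sum-const (suc n) c = cong (c +_) (sum-const n c)

+-interchange : ∀ a b c d → (a + b) + (c + d) ≡ (a + c) + (b + d)
+-interchange a b c d = begin
  (a + b) + (c + d) ≡⟨ +-assoc a b (c + d) ⟩
  a + (b + (c + d)) ≡⟨ cong (a +_) (sym (+-assoc b c d)) ⟩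
  a + (b + c + d)   ≡⟨ cong (λ x → a + (x + d)) (+-comm b c) ⟩
  a + (c + b + d)   ≡⟨ cong (a +_) (+-assoc c b d) ⟩
  a + (c + (b + d)) ≡⟨ sym (+-assoc a c (b + d)) ⟩
  (a + c) + (b + d) ∎
  where open ≡-Reasoning

sum-+ : ∀ n (f g : Fin n → ℕ) → sumFin n (λ i → f i + g i) ≡ sumFin n f + sumFin n g
sum-+ zero    f g = refl
sum-+ (suc n) f g = trans (cong ((f zero + g zero) +_) (sum-+ n (f ∘ suc) (g ∘ suc)))
                          (+-interchange (f zero) (g zero) _ _)

sum-swap : ∀ n m (f : Fin n → Fin m → ℕ) →
  sumFin n (λ i → sumFin m (f i)) ≡ sumFin m (λ j → sumFin n (λ i → f i j))
sum-swap zero    m f = sym (sum-zero m)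
sum-swap (suc n) m f = trans (cong (sumFin m (f zero) +_) (sum-swap n m (f ∘ suc)))
                             (sym (sum-+ m (f zero) _))

sum-ind : ∀ n b (f : Fin n → ℕ) → sumFin n (λ i → ind b (f i)) ≡ ind b (sumFin n f)
sum-ind n true  f = refl
sum-ind n false f = sum-zero n

sum-δ : ∀ (j : Fin n) (f : Fin n → ℕ) → sumFin n (λ i → ind (does (j ≟ i)) (f i)) ≡ f j
sum-δ {suc n} zero    f = trans (cong (f zero +_) (sum-zero n)) (+-identityʳ _)
sum-δ {suc n} (suc j) f = sum-δ j (f ∘ suc)

sum-δ′ : ∀ (j : Fin n) (f : Fin n → ℕ) → sumFin n (λ i → ind (does (i ≟ j)) (f i)) ≡ f j
sum-δ′ j f = trans (sum-cong λ i → cong (λ b → ind b (f i)) ([]-⇔ (i ≟ j) (j ≟ i) sym sym)) (sum-δ j f)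

sum-bij : (σ : Fin n → Fin m) (τ : Fin m → Fin n) → (∀ x → τ (σ x) ≡ x) → (∀ y → σ (τ y) ≡ y) →
  ∀ f → sumFin n (f ∘ σ) ≡ sumFin m f
sum-bij {n} {m} σ τ τσ στ f = begin
  sumFin n (f ∘ σ)
    ≡⟨ sum-cong (λ x → sum-δ (σ x) f) ⟨
  sumFin n (λ x → sumFin m (λ y → ind (does (σ x ≟ y)) (f y)))
    ≡⟨ sum-swap n m _ ⟩
  sumFin m (λ y → sumFin n (λ x → ind (does (σ x ≟ y)) (f y)))
    ≡⟨ sum-cong (λ y → sum-cong λ x → cong (λ b → ind b (f y))
         ([]-⇔ (σ x ≟ y) (τ y ≟ x) (λ e → trans (cong τ (sym e)) (τσ x)) (λ e → trans (cong σ (sym e)) (στ y)))) ⟩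
  sumFin m (λ y → sumFin n (λ x → ind (does (τ y ≟ x)) (f y)))
    ≡⟨ sum-cong (λ y → sum-δ (τ y) (λ _ → f y)) ⟩
  sumFin m f ∎
  where open ≡-Reasoning

sum-≥ : ∀ (f : Fin n → ℕ) i → f i ≤ sumFin n f
sum-≥ f zero    = m≤m+n _ _
sum-≥ f (suc i) = ≤-trans (sum-≥ (f ∘ suc) i) (m≤n+m _ _)

sum-positive : ∀ (f : Fin n → ℕ) → 1 ≤ sumFin n f → ∃ λ i → 1 ≤ f i
sum-positive {suc n} f h with f zero in eq
... | suc _ = zero , ≤-trans (s≤s z≤n) (≤-reflexive (sym eq))
... | zero  with i , p ← sum-positive (f ∘ suc) h = suc i , p

sum-unique : ∀ (f : Fin n → ℕ) → sumFin n f ≤ 1 → ∀ i j → 1 ≤ f i → 1 ≤ f j → i ≡ j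
sum-unique f h zero    zero    p q = refl
sum-unique f h zero    (suc j) p q =
  contradiction (≤-trans (+-mono-≤ p (≤-trans q (sum-≥ (f ∘ suc) j))) h) λ { (s≤s ()) }
sum-unique f h (suc i) zero    p q =
  contradiction (≤-trans (+-mono-≤ q (≤-trans p (sum-≥ (f ∘ suc) i))) h) λ { (s≤s ()) }
sum-unique f h (suc i) (suc j) p q = cong suc (sum-unique (f ∘ suc) (≤-trans (m≤n+m _ _) h) i j p q)

sum-↑ : ∀ n m (f : Fin (n + m) → ℕ) →
  sumFin (n + m) f ≡ sumFin n (λ i → f (i ↑ˡ m)) + sumFin m (λ j → f (n ↑ʳ j))
sum-↑ zero    m f = refl
sum-↑ (suc n) m f = trans (cong (f zero +_) (sum-↑ n m (f ∘ suc))) (sym (+-assoc (f zero) _ _))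

sum-combine : ∀ n m (f : Fin (n * m) → ℕ) →
  sumFin (n * m) f ≡ sumFin n (λ i → sumFin m (λ j → f (combine i j)))
sum-combine zero    m f = refl
sum-combine (suc n) m f = trans (sum-↑ m (n * m) f) (cong (sumFin m (λ j → f (j ↑ˡ (n * m))) +_) (sum-combine n m (λ x → f (m ↑ʳ x))))

-- Lays out the pairs `(e , p)` consecutively. The edges of the double are indexed this way, with
-- `p` ranging over the copies of the edge `e`.
split : (a : Fin n → ℕ) → Fin (sumFin n a) → Σ (Fin n) (Fin ∘ a)
split {suc n} a i with splitAt (a zero) i
... | inj₁ j = zero , j
... | inj₂ j with e , p ← split (a ∘ suc) j = suc e , p

sum-split : (a : Fin n → ℕ) (f : Σ (Fin n) (Fin ∘ a) → ℕ) →
  sumFin (sumFin n a) (f ∘ split a) ≡ sumFin n (λ e → sumFin (a e) (λ p → f (e , p)))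
sum-split {zero}  a f = refl
sum-split {suc n} a f = trans (sum-↑ (a zero) _ _) (cong₂ _+_
  (sum-cong λ i → cong f (left i))
  (trans (sum-cong λ j → cong f (right j)) (sum-split (a ∘ suc) (λ { (e , p) → f (suc e , p) }))))
  where
  left : ∀ i → split a (i ↑ˡ sumFin n (a ∘ suc)) ≡ (zero , i)
  left i rewrite splitAt-↑ˡ (a zero) i (sumFin n (a ∘ suc)) = refl
  right : ∀ j → split a (a zero ↑ʳ j) ≡ (suc (proj₁ (split (a ∘ suc) j)) , proj₂ (split (a ∘ suc) j))
  right j rewrite splitAt-↑ʳ (a zero) (sumFin n (a ∘ suc)) j = refl

-- The points of `p` moved by the involution fall into pairs `x`, `f x`; `h` counts the smaller
-- member of each pair.
#-parity : (f : Fin n → Fin n) → (∀ x → f (f x) ≡ x) → (p : Fin n → Bool) → (∀ x → p (f x) ≡ p x) →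
  ∃ λ h → # p ≡ # (λ x → p x ∧ does (f x ≟ x)) + (h + h)
#-parity {n} f inv p pf = sumFin n up , (begin
  # p                                            ≡⟨ sum-cong cases ⟩
  sumFin n (λ x → fixed x + (up x + up (f x)))   ≡⟨ sum-+ n fixed _ ⟩
  sumFin n fixed + sumFin n (λ x → up x + up (f x))
    ≡⟨ cong (sumFin n fixed +_) (trans (sum-+ n up (up ∘ f)) (cong (sumFin n up +_) (sum-bij f f inv inv up))) ⟩
  sumFin n fixed + (sumFin n up + sumFin n up)   ∎)
  where
  open ≡-Reasoning
  fixed up : Fin n → ℕ
  fixed x = ind (p x ∧ does (f x ≟ x)) 1
  up x = ind (p x ∧ does (toℕ x <? toℕ (f x))) 1
  cases : ∀ x → ind (p x) 1 ≡ fixed x + (up x + up (f x))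
  cases x rewrite pf x | inv x with p x
  ... | false = refl
  ... | true with f x ≟ x | <-cmp (toℕ x) (toℕ (f x))
  ... | yes e | tri< l _ _  = contradiction (cong toℕ (sym e)) (<⇒≢ l)
  ... | yes e | tri> _ _ l  = contradiction (cong toℕ e) (<⇒≢ l)
  ... | yes e | tri≈ ¬l _ ¬g = sym (cong₂ (λ a b → 1 + (ind a 1 + ind b 1)) (dec-false (_ <? _) ¬l) (dec-false (_ <? _) ¬g))
  ... | no ¬e | tri< l _ ¬g = sym (cong₂ (λ a b → ind a 1 + ind b 1) (dec-true (_ <? _) l) (dec-false (_ <? _) ¬g))
  ... | no ¬e | tri> ¬l _ g = sym (cong₂ (λ a b → ind a 1 + ind b 1) (dec-false (_ <? _) ¬l) (dec-true (_ <? _) g))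
  ... | no ¬e | tri≈ _ e _  = contradiction (toℕ-injective (sym e)) ¬e

[]-yes : {P : Set} (p? : Dec P) → P → [ p? ] ≡ 1
[]-yes p? p = cong (λ b → ind b 1) (dec-true p? p)

[]-no : {P : Set} (p? : Dec P) → ¬ P → [ p? ] ≡ 0
[]-no p? ¬p = cong (λ b → ind b 1) (dec-false p? ¬p)

[]-mono : {P Q : Set} (p? : Dec P) (q? : Dec Q) → (P → Q) → [ p? ] ≤ [ q? ]
[]-mono (yes p) q? f = ≤-reflexive (sym ([]-yes q? (f p)))
[]-mono (no ¬p) q? f = z≤n

sum-singleton : (a : Fin n) → sumFin n (λ i → [ i ≟ a ]) ≡ 1
sum-singleton a = sum-δ′ a (λ _ → 1)

-- Each indicator sums to 1, so the two cancel: a unit gained at `b` is paid for by a unit lost at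
-- `a`.
sum-exchange-≤ : ∀ (f g : Fin n → ℕ) a b → (∀ t → f t + [ t ≟ a ] ≤ g t + [ t ≟ b ]) → sumFin n f ≤ sumFin n g
sum-exchange-≤ {n} f g a b h = +-cancelʳ-≤ 1 _ _ (begin
  sumFin n f + 1                                ≡⟨ cong (sumFin n f +_) (sum-singleton a) ⟨
  sumFin n f + sumFin n (λ i → [ i ≟ a ])       ≡⟨ sum-+ n f _ ⟨
  sumFin n (λ i → f i + [ i ≟ a ])              ≤⟨ sum-mono h ⟩
  sumFin n (λ i → g i + [ i ≟ b ])              ≡⟨ sum-+ n g _ ⟩
  sumFin n g + sumFin n (λ i → [ i ≟ b ])       ≡⟨ cong (sumFin n g +_) (sum-singleton b) ⟩
  sumFin n g + 1                                ∎)
  where open ≤-Reasoning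

sum-strict-mono : ∀ (f g : Fin n → ℕ) a → (∀ t → f t + [ t ≟ a ] ≤ g t) → sumFin n f < sumFin n g
sum-strict-mono {n} f g a h = begin
  suc (sumFin n f)                              ≡⟨ +-comm 1 (sumFin n f) ⟩
  sumFin n f + 1                                ≡⟨ cong (sumFin n f +_) (sum-singleton a) ⟨
  sumFin n f + sumFin n (λ i → [ i ≟ a ])       ≡⟨ sum-+ n f _ ⟨
  sumFin n (λ i → f i + [ i ≟ a ])              ≤⟨ sum-mono h ⟩
  sumFin n g                                    ∎
  where open ≤-Reasoning

#-≤ : (p : Fin n → Bool) → # p ≤ n
#-≤ {n} p = ≤-trans (sum-mono λ i → ind≤ (p i) 1) (≤-reflexive (trans (sum-const n 1) (*-identityʳ n)))

-- Tutte's theorem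

-- A Tutte barrier: the vertices outside S fall into pairwise non-adjacent
-- classes c ⁻¹(z), and more than |S| of them are odd.
record Barrier (R : Fin n → Fin n → Set) : Set where
  field
    S     : Fin n → Bool
    c     : Fin n → Fin n
    root  : Fin n → Bool
    sep   : ∀ {u v} → R u v → S u ≡ false → S v ≡ false → c u ≡ c v
    odd   : ∀ z → root z ≡ true → ∃ λ h → # (λ w → not (S w) ∧ does (c w ≟ z)) ≡ suc (h + h)
    more  : # S < # root

does-true : {P : Set} (p? : Dec P) → does p? ≡ true → P
does-true (yes p) _ = p

bool-cong : ∀ {a b} → (a ≡ true → b ≡ true) → (b ≡ true → a ≡ true) → a ≡ b
bool-cong {false} {false} f g = refl
bool-cong {false} {true}  f g = g refl
bool-cong {true}  {b}     f g = sym (f refl)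

abstract
  -- Exhaustive search over the codes of all functions. A decoded code agrees with the function only
  -- pointwise, so `resp` stands in for extensionality; `abstract` keeps the search from being
  -- unfolded.
  ∃-function? : (P : (Fin n → Fin m) → Set) → (∀ f → Dec (P f)) →
    (∀ f g → (∀ t → f t ≡ g t) → P f → P g) → Dec (∃ P)
  ∃-function? P P? resp = map′
    (λ { (i , p) → finToFun i , p })
    (λ { (f , p) → funToFin f , resp f _ (λ t → sym (finToFun-funToFin f t)) p })
    (any? (P? ∘ finToFun))

module Tutte {m : ℕ} (R : Fin m → Fin m → Set) (R? : ∀ u v → Dec (R u v))
             (R-sym : ∀ {u v} → R u v → R v u) where

  -- A matching that avoids S, as the involution exchanging the two ends of
  -- each of its edges; its fixed points are the unmatched vertices.
  Match : (Fin m → Bool) → (Fin m → Fin m) → Set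
  Match S f = (∀ v → f (f v) ≡ v) × (∀ v → f v ≡ v ⊎ R v (f v)) × (∀ v → S v ≡ true → f v ≡ v)

  missed : (Fin m → Fin m) → ℕ
  missed f = # (λ v → does (f v ≟ v))

  Match? : ∀ S f → Dec (Match S f)
  Match? S f = all? (λ v → f (f v) ≟ v) ×-dec all? (λ v → (f v ≟ v) ⊎-dec R? v (f v))
         ×-dec all? (λ v → (S v Bool.≟ true) →-dec (f v ≟ v))

  Match-resp : ∀ S f g → (∀ t → f t ≡ g t) → Match S f → Match S g
  Match-resp S f g e (inv , adj , av) =
    (λ v → trans (sym (trans (e (f v)) (cong g (e v)))) (inv v)) ,
    (λ v → subst (λ w → w ≡ v ⊎ R v w) (e v) (adj v)) ,
    (λ v s → trans (sym (e v)) (av v s))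

  missed-resp : ∀ f g → (∀ t → f t ≡ g t) → missed f ≡ missed g
  missed-resp f g e = sum-cong λ t → cong (λ w → [ w ≟ t ]) (e t)

  -- For `x` missed by `N`: matches `x` with `y` and abandons the former partner `N y`. The missed
  -- vertex thus moves from `x` to `N y`, or both `x` and `y` become covered if `y` was missed too.
  shift : (Fin m → Fin m) → Fin m → Fin m → Fin m → Fin m
  shift N x y t = if does (t ≟ x) then y else if does (t ≟ y) then x else if does (t ≟ N y) then t else N t

  data Shift (N : Fin m → Fin m) (x y t : Fin m) : Fin m → Set where
    at-x  : t ≡ x → Shift N x y t y
    at-y  : t ≢ x → t ≡ y → Shift N x y t x
    at-z  : t ≢ x → t ≢ y → t ≡ N y → Shift N x y t t
    other : t ≢ x → t ≢ y → t ≢ N y → Shift N x y t (N t)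

  shift-view : ∀ N x y t → Shift N x y t (shift N x y t)
  shift-view N x y t with t ≟ x
  ... | yes p = at-x p
  ... | no p with t ≟ y
  ... | yes q = at-y p q
  ... | no q with t ≟ N y
  ... | yes r = at-z p q r
  ... | no r = other p q r

  shift-eq : ∀ {N x y t s} → Shift N x y t s → shift N x y t ≡ s
  shift-eq {N} {x} {y} {t} (at-x p) rewrite dec-true (t ≟ x) p = refl
  shift-eq {N} {x} {y} {t} (at-y p q) rewrite dec-false (t ≟ x) p | dec-true (t ≟ y) q = refl
  shift-eq {N} {x} {y} {t} (at-z p q r) rewrite dec-false (t ≟ x) p | dec-false (t ≟ y) q | dec-true (t ≟ N y) r = refl
  shift-eq {N} {x} {y} {t} (other p q r) rewrite dec-false (t ≟ x) p | dec-false (t ≟ y) q | dec-false (t ≟ N y) r = refl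

  module _ {S N x y} (mat : Match S N) (Nx : N x ≡ x) (x≢y : x ≢ y) where
    private
      inv = proj₁ mat

    shift-match : R x y → S x ≡ false → S y ≡ false → Match S (shift N x y)
    shift-match r Sx Sy = involutive , adjacent , avoids
      where
      involutive : ∀ t → shift N x y (shift N x y t) ≡ t
      involutive t with shift N x y t | shift-view N x y t
      ... | _ | at-x p = trans (shift-eq {N} {x} {y} (at-y (x≢y ∘ sym) refl)) (sym p)
      ... | _ | at-y p q = trans (shift-eq {N} {x} {y} (at-x refl)) (sym q)
      ... | _ | at-z p q s = shift-eq (at-z p q s)
      ... | _ | other p q s = trans (shift-eq (other
        (λ e → p (trans (sym (inv t)) (trans (cong N e) Nx)))
        (λ e → s (trans (sym (inv t)) (cong N e)))
        (λ e → q (trans (sym (inv t)) (trans (cong N e) (inv y)))))) (inv t)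
      adjacent : ∀ t → shift N x y t ≡ t ⊎ R t (shift N x y t)
      adjacent t with shift N x y t | shift-view N x y t
      ... | _ | at-x p = inj₂ (subst (λ w → R w y) (sym p) r)
      ... | _ | at-y p q = inj₂ (subst (λ w → R w x) (sym q) (R-sym r))
      ... | _ | at-z p q s = inj₁ refl
      ... | _ | other p q s = proj₁ (proj₂ mat) t
      avoids : ∀ t → S t ≡ true → shift N x y t ≡ t
      avoids t St with shift N x y t | shift-view N x y t
      ... | _ | at-x p = contradiction (trans (sym St) (trans (cong S p) Sx)) λ ()
      ... | _ | at-y p q = contradiction (trans (sym St) (trans (cong S q) Sy)) λ ()
      ... | _ | at-z p q s = refl
      ... | _ | other p q s = proj₂ (proj₂ mat) t St

    shift-missed-≤ : missed (shift N x y) ≤ missed N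
    shift-missed-≤ = sum-exchange-≤ _ _ x (N y) pointwise
      where
      pointwise : ∀ t → [ shift N x y t ≟ t ] + [ t ≟ x ] ≤ [ N t ≟ t ] + [ t ≟ N y ]
      pointwise t with shift N x y t | shift-view N x y t
      ... | _ | at-x refl rewrite []-no (y ≟ t) (x≢y ∘ sym) | []-yes (t ≟ t) refl | []-yes (N t ≟ t) Nx = s≤s z≤n
      ... | _ | at-y p refl rewrite []-no (x ≟ t) x≢y | []-no (t ≟ x) p = z≤n
      ... | _ | at-z p q s rewrite []-yes (t ≟ t) refl | []-no (t ≟ x) p | []-yes (t ≟ N y) s = m≤n+m 1 _
      ... | _ | other p q s rewrite []-no (t ≟ x) p = +-monoʳ-≤ _ z≤n

    shift-missed-< : N y ≡ y → missed (shift N x y) < missed N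
    shift-missed-< Ny = sum-strict-mono _ _ x pointwise
      where
      pointwise : ∀ t → [ shift N x y t ≟ t ] + [ t ≟ x ] ≤ [ N t ≟ t ]
      pointwise t with shift N x y t | shift-view N x y t
      ... | _ | at-x refl rewrite []-no (y ≟ t) (x≢y ∘ sym) | []-yes (t ≟ t) refl | []-yes (N t ≟ t) Nx = s≤s z≤n
      ... | _ | at-y p refl rewrite []-no (x ≟ t) x≢y | []-no (t ≟ x) p = z≤n
      ... | _ | at-z p q s = contradiction (trans s Ny) q
      ... | _ | other p q s rewrite []-no (t ≟ x) p | +-identityʳ [ N t ≟ t ] = ≤-refl

  match-S : ∀ {S f} → Match S f → ∀ t → S (f t) ≡ S t
  match-S {S} {f} (inv , adj , av) t = bool-cong
    (λ e → subst (λ w → S w ≡ true) (trans (sym (av (f t) e)) (inv t)) e)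
    (λ e → subst (λ w → S w ≡ true) (sym (av t e)) e)

  switch : (Fin m → Bool) → (Fin m → Fin m) → (Fin m → Fin m) → Fin m → Fin m
  switch p f g t = if p t then f t else g t

  switch-match : ∀ {S f g} p → Match S f → Match S g → (∀ t → p (f t) ≡ p t) → (∀ t → p (g t) ≡ p t) →
    Match S (switch p f g)
  switch-match {S} {f} {g} p mf mg pf pg = involutive , adjacent , avoids
    where
    L = switch p f g
    involutive : ∀ t → L (L t) ≡ t
    involutive t with p t in eq
    ... | true rewrite trans (pf t) eq = proj₁ mf t
    ... | false rewrite trans (pg t) eq = proj₁ mg t
    adjacent : ∀ t → L t ≡ t ⊎ R t (L t)
    adjacent t with p t
    ... | true = proj₁ (proj₂ mf) t
    ... | false = proj₁ (proj₂ mg) t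
    avoids : ∀ t → S t ≡ true → L t ≡ t
    avoids t St with p t
    ... | true = proj₂ (proj₂ mf) t St
    ... | false = proj₂ (proj₂ mg) t St

  switch-missed-< : ∀ p f g v → (∀ t → p t ≡ true → f t ≢ t) → p v ≡ true → g v ≡ v →
    missed (switch p f g) < missed g
  switch-missed-< p f g v pf pv gv = sum-strict-mono _ _ v pointwise
    where
    pointwise : ∀ t → [ switch p f g t ≟ t ] + [ t ≟ v ] ≤ [ g t ≟ t ]
    pointwise t with p t in eq
    ... | true rewrite []-no (f t ≟ t) (pf t eq) = []-mono (t ≟ v) (g t ≟ t) λ { refl → gv }
    ... | false rewrite []-no (t ≟ v) (λ { refl → contradiction (trans (sym eq) pv) λ () }) | +-identityʳ [ g t ≟ t ] = ≤-refl

  -- d is the least number of vertices missed by a matching that avoids S.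
  module Optimal (S : Fin m → Bool) (d : ℕ) (minimal : ∀ g → Match S g → d ≤ missed g) where

    Opt : (Fin m → Fin m) → Set
    Opt f = Match S f × missed f ≤ d

    BothMissed : Fin m → Fin m → Set
    BothMissed u v = ∃ λ f → Opt f × f u ≡ u × f v ≡ v

    bothMissed? : ∀ u v → Dec (BothMissed u v)
    bothMissed? u v = ∃-function? _
      (λ f → (Match? S f ×-dec (missed f ≤? d)) ×-dec (f u ≟ u) ×-dec (f v ≟ v))
      (λ { f g e ((mf , fd) , fu , fv) →
        (Match-resp S f g e mf , subst (_≤ d) (missed-resp f g e) fd) , trans (sym (e u)) fu , trans (sym (e v)) fv })

    -- Once every vertex outside `S` is missed by some optimal matching, this is an equivalence
    -- there. Its classes serve as the odd components of the barrier.
    _≈_ : Fin m → Fin m → Set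
    u ≈ v = u ≡ v ⊎ ¬ BothMissed u v

    _≈?_ : ∀ u v → Dec (u ≈ v)
    u ≈? v = (u ≟ v) ⊎-dec ¬? (bothMissed? u v)

    ≈-sym : ∀ {u v} → u ≈ v → v ≈ u
    ≈-sym (inj₁ e) = inj₁ (sym e)
    ≈-sym (inj₂ h) = inj₂ λ { (f , o , p , q) → h (f , o , q , p) }

    ≈-eq : ∀ {f u v} → Opt f → f u ≡ u → f v ≡ v → u ≈ v → u ≡ v
    ≈-eq o fu fv (inj₁ e) = e
    ≈-eq o fu fv (inj₂ h) = contradiction (_ , o , fu , fv) h

    -- An optimal matching that missed both could be enlarged by the edge between them.
    adjacent-≈ : ∀ {u v} → R u v → S u ≡ false → S v ≡ false → u ≈ v
    adjacent-≈ {u} {v} r Su Sv with u ≟ v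
    ... | yes e = inj₁ e
    ... | no u≢v = inj₂ λ { (f , (mf , fd) , fu , fv) →
      <⇒≱ (≤-trans (shift-missed-< mf fu u≢v fv) fd) (minimal _ (shift-match mf fu u≢v r Su Sv)) }

    match-≈ : ∀ {f} → Match S f → ∀ t → S t ≡ false → t ≈ f t
    match-≈ {f} mf t St with proj₁ (proj₂ mf) t
    ... | inj₁ e = inj₁ (sym e)
    ... | inj₂ r = adjacent-≈ r St (trans (match-S mf t) St)

    -- Gallai's lemma: among the optimal N missing v, each step gets closer to M.
    module Gallai {M u v w} (oM : Opt M) (Mu : M u ≡ u) (Mw : M w ≡ w) (u≢w : u ≢ w)
                  (uv : ¬ BothMissed u v) (vw : ¬ BothMissed v w) where

      agree : (Fin m → Fin m) → ℕ
      agree N = # (λ t → does (N t ≟ M t))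

      -- If `N` misses some `x` other than `v` that `M` covers, `x` is rematched to `M x`, as in
      -- `M`. Optimality of `N` forces `M x` to have had a partner in `N`, which becomes missed
      -- instead. At that partner `N` and `M` disagreed already, so no agreement is lost, and one is
      -- gained at `x`.
      step : ∀ N → Opt N → N v ≡ v → ∃ λ N′ → Opt N′ × N′ v ≡ v × agree N < agree N′
      step N oN Nv with any? (λ x → (N x ≟ x) ×-dec ¬? (x ≟ v) ×-dec ¬? (M x ≟ x))
      ... | yes (x , Nx , x≢v , Mx) = shift N x y
          , (shift-match mN Nx (Mx ∘ sym) r Sx Sy , ≤-trans (shift-missed-≤ mN Nx (Mx ∘ sym)) (proj₂ oN))
          , trans (shift-eq (other (x≢v ∘ sym) (λ e → Ny (subst (λ s → N s ≡ s) e Nv))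
              (λ e → Ny (trans (trans (sym e) (trans (sym Nv) (cong N e))) (proj₁ mN y))))) Nv
          , sum-strict-mono _ _ x pointwise
        where
        mN = proj₁ oN
        mM = proj₁ oM
        y = M x
        My : M y ≡ x
        My = proj₁ mM x
        outside : ∀ {t} → M t ≢ t → S t ≡ false
        outside {t} h with S t in eq
        ... | true = contradiction (proj₂ (proj₂ mM) t eq) h
        ... | false = refl
        Sx = outside Mx
        Sy = outside (λ e → Mx (trans (sym e) My))
        r : R x y
        r = [ (λ e → contradiction e Mx) , id ]′ (proj₁ (proj₂ mM) x)
        Ny : N y ≢ y
        Ny e = <⇒≱ (≤-trans (shift-missed-< mN Nx (Mx ∘ sym) e) (proj₂ oN))
                   (minimal _ (shift-match mN Nx (Mx ∘ sym) r Sx Sy))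
        pointwise : ∀ t → [ N t ≟ M t ] + [ t ≟ x ] ≤ [ shift N x y t ≟ M t ]
        pointwise t with shift N x y t | shift-view N x y t
        ... | _ | at-x refl rewrite []-no (N t ≟ M t) (λ e → Mx (trans (sym e) Nx)) | []-yes (t ≟ t) refl
                                  | []-yes (M t ≟ M t) refl = ≤-refl
        ... | _ | at-y p refl rewrite []-no (t ≟ x) p | []-yes (x ≟ M t) (sym My) | +-identityʳ [ N t ≟ M t ] = ind≤ _ 1
        ... | _ | at-z p q s rewrite []-no (t ≟ x) p
                | []-no (N t ≟ M t) (λ e → p (trans (sym (proj₁ mM t)) (trans (cong M (trans (sym e) (trans (cong N s) (proj₁ mN y)))) My)))
                = z≤n
        ... | _ | other p q s rewrite []-no (t ≟ x) p | +-identityʳ [ N t ≟ M t ] = ≤-refl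
      -- Now every vertex missed by `N`, except `v`, is missed by `M`, while `M` also misses `u` and
      -- `w`, both covered by `N`. Hence `M` misses more than `N`, against the optimality of `M`.
      ... | no none = contradiction fewer (<⇒≱ more)
        where
        Nu : N u ≢ u
        Nu e = uv (N , oN , e , Nv)
        Nw : N w ≢ w
        Nw e = vw (N , oN , Nv , e)
        pointwise : ∀ t → [ N t ≟ t ] + [ t ≟ u ] + [ t ≟ w ] ≤ [ M t ≟ t ] + [ t ≟ v ]
        pointwise t with N t ≟ t
        ... | yes Nt rewrite []-no (t ≟ u) (λ { refl → Nu Nt }) | []-no (t ≟ w) (λ { refl → Nw Nt }) with t ≟ v
        ... | yes _ = m≤n+m 1 _
        ... | no t≢v with M t ≟ t
        ... | yes _ = ≤-refl
        ... | no Mt = contradiction (t , Nt , t≢v , Mt) none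
        pointwise t | no _ with t ≟ u | t ≟ w
        ... | yes refl | yes e rewrite []-yes (M t ≟ t) Mu = contradiction e u≢w
        ... | yes refl | no _  rewrite []-yes (M t ≟ t) Mu = s≤s z≤n
        ... | no _ | yes refl  rewrite []-yes (M t ≟ t) Mw = s≤s z≤n
        ... | no _ | no _ = z≤n
        fewer : missed M ≤ missed N
        fewer = ≤-trans (proj₂ oM) (minimal N (proj₁ oN))
        more : missed N < missed M
        more = +-cancelʳ-≤ 1 _ _ (begin
          suc (missed N) + 1                             ≡⟨ cong (_+ 1) (+-comm 1 (missed N)) ⟩
          missed N + 1 + 1                               ≡⟨ cong₂ (λ a b → missed N + a + b) (sum-singleton u) (sum-singleton w) ⟨
          missed N + # (λ t → does (t ≟ u)) + # (λ t → does (t ≟ w))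
            ≡⟨ trans (sum-+ m _ _) (cong (_+ # (λ t → does (t ≟ w))) (sum-+ m _ _)) ⟨
          sumFin m (λ t → [ N t ≟ t ] + [ t ≟ u ] + [ t ≟ w ]) ≤⟨ sum-mono pointwise ⟩
          sumFin m (λ t → [ M t ≟ t ] + [ t ≟ v ])       ≡⟨ sum-+ m _ _ ⟩
          missed M + # (λ t → does (t ≟ v))              ≡⟨ cong (missed M +_) (sum-singleton v) ⟩
          missed M + 1                                   ∎)
          where open ≤-Reasoning

      -- `agree` grows with each step but is bounded by `m`.
      climb : ∀ fuel N → Opt N → N v ≡ v → m < fuel + agree N → ⊥
      climb zero       N oN Nv h = <⇒≱ h (#-≤ _)
      climb (suc fuel) N oN Nv h with N′ , oN′ , Nv′ , a ← step N oN Nv =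
        climb fuel N′ oN′ Nv′ (≤-trans h (≤-trans (≤-reflexive (sym (+-suc fuel (agree N)))) (+-monoʳ-≤ fuel a)))

    module AllMissable (M : Fin m → Fin m) (oM : Opt M)
                       (missable : ∀ v → S v ≡ false → ∃ λ f → Opt f × f v ≡ v) where

      -- Gallai's lemma, started from the optimal matching missing `v` that `missable` provides.
      ≈-trans : ∀ {u v w} → S v ≡ false → u ≈ v → v ≈ w → u ≈ w
      ≈-trans Sv (inj₁ refl) h = h
      ≈-trans Sv h (inj₁ refl) = h
      ≈-trans {u} {v} {w} Sv (inj₂ uv) (inj₂ vw) with u ≟ w
      ... | yes e = inj₁ e
      ... | no u≢w = inj₂ λ { (M′ , oM′ , Mu , Mw) →
        let N , oN , Nv = missable v Sv in
        Gallai.climb oM′ Mu Mw u≢w uv vw (suc m) N oN Nv (m≤m+n (suc m) _) }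

      private
        mM = proj₁ oM

      -- Together with `≈-eq` this puts exactly one vertex missed by `M` into each class. As `M`
      -- pairs off the rest inside the class, every class is odd.
      representative : ∀ v → S v ≡ false → ∃ λ z → S z ≡ false × M z ≡ z × v ≈ z
      representative v Sv with any? (λ z → (S z Bool.≟ false) ×-dec (M z ≟ z) ×-dec (v ≈? z))
      ... | yes h = h
      ... | no none = contradiction (≤-trans fewer (proj₂ oN)) (≤⇒≯ (minimal _ (switch-match _ mM mN (stable mM) (stable mN))))
        where
        N = proj₁ (missable v Sv)
        oN = proj₁ (proj₂ (missable v Sv))
        Nv = proj₂ (proj₂ (missable v Sv))
        mN = proj₁ oN
        class? : ∀ t → Dec (S t ≡ false × v ≈ t)
        class? t = (S t Bool.≟ false) ×-dec (v ≈? t)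
        stable : ∀ {f} → Match S f → ∀ t → does (class? (f t)) ≡ does (class? t)
        stable {f} mf t = []-⇔ (class? (f t)) (class? t)
          (λ { (s , e) → let St = trans (sym (match-S mf t)) s in St , ≈-trans s e (≈-sym (match-≈ mf t St)) })
          (λ { (s , e) → trans (match-S mf t) s , ≈-trans s e (match-≈ mf t s) })
        -- No vertex of the class of v is missed by M, so switching from N to M
        -- on this class gains the vertex v.
        fewer : missed (switch (does ∘ class?) M N) < missed N
        fewer = switch-missed-< (does ∘ class?) M N v
          (λ t h Mt → none (t , proj₁ (does-true (class? t) h) , Mt , proj₂ (does-true (class? t) h)))
          (dec-true (class? v) (Sv , inj₁ refl)) Nv

      abstract
        label : ∀ v → ∃ λ z → S v ≡ false → S z ≡ false × M z ≡ z × v ≈ z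
        label v with S v in eq
        ... | true  = v , λ ()
        ... | false with z , h ← representative v eq = z , λ _ → h

      -- Matchings avoiding `S` miss all of `S`, so `missed M` is the number of classes plus `# S`.
      -- The bound `# S + # S` is therefore Tutte's condition with `# S` added to both sides.
      barrier : # S + # S < missed M → Barrier R
      barrier large = record
        { S = S ; c = c ; root = root ; sep = sep ; odd = odd ; more = +-cancelʳ-≤ (# S) _ _ (≤-trans large (≤-reflexive count)) }
        where
        c : Fin m → Fin m
        c v = proj₁ (label v)
        root : Fin m → Bool
        root z = not (S z) ∧ does (M z ≟ z)
        count : missed M ≡ # root + # S
        count = trans (sum-cong pointwise) (sum-+ m _ _)
          where
          pointwise : ∀ t → [ M t ≟ t ] ≡ ind (root t) 1 + ind (S t) 1
          pointwise t with S t in eq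
          ... | true = []-yes (M t ≟ t) (proj₂ (proj₂ mM) t eq)
          ... | false = sym (+-identityʳ _)
        c-unique : ∀ {v z} → S v ≡ false → S z ≡ false → M z ≡ z → v ≈ z → c v ≡ z
        c-unique {v} {z} Sv Sz Mz e with _ , Mc , e′ ← proj₂ (label v) Sv =
          ≈-eq oM Mc Mz (≈-trans Sv (≈-sym e′) e)
        c-cong : ∀ {u v} → u ≈ v → S u ≡ false → S v ≡ false → c u ≡ c v
        c-cong {u} {v} e Su Sv with Sc , Mc , e′ ← proj₂ (label v) Sv = c-unique Su Sc Mc (≈-trans Sv e e′)
        sep : ∀ {u v} → R u v → S u ≡ false → S v ≡ false → c u ≡ c v
        sep r Su Sv = c-cong (adjacent-≈ r Su Sv) Su Sv
        odd : ∀ z → root z ≡ true → ∃ λ h → # (λ w → not (S w) ∧ does (c w ≟ z)) ≡ suc (h + h)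
        odd z rz with S z in Sz | M z ≟ z
        ... | false | yes Mz = proj₁ parity , trans (proj₂ parity) (cong (_+ (proj₁ parity + proj₁ parity)) only)
          where
          stable : ∀ x → not (S (M x)) ∧ does (c (M x) ≟ z) ≡ not (S x) ∧ does (c x ≟ z)
          stable x rewrite match-S mM x with S x in Sx
          ... | true = refl
          ... | false = cong (λ w → does (w ≟ z)) (sym (c-cong (match-≈ mM x Sx) Sx (trans (match-S mM x) Sx)))
          parity = #-parity M (proj₁ mM) (λ w → not (S w) ∧ does (c w ≟ z)) stable
          only : # (λ x → (not (S x) ∧ does (c x ≟ z)) ∧ does (M x ≟ x)) ≡ 1
          only = trans (sum-cong λ x → cong (λ b → ind b 1) (bool-cong (to x) (from x))) (sum-singleton z)
            where
            to : ∀ x → (not (S x) ∧ does (c x ≟ z)) ∧ does (M x ≟ x) ≡ true → does (x ≟ z) ≡ true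
            to x h with S x in Sx | c x ≟ z | M x ≟ x
            to x h | false | yes e | yes Mx = dec-true (x ≟ z) (trans (sym (c-unique Sx Sx Mx (inj₁ refl))) e)
            from : ∀ x → does (x ≟ z) ≡ true → (not (S x) ∧ does (c x ≟ z)) ∧ does (M x ≟ x) ≡ true
            from x h with x ≟ z
            ... | yes refl rewrite Sz | dec-true (c x ≟ x) (c-unique Sz Sz Mz (inj₁ refl)) = dec-true (M x ≟ x) Mz

  -- Optimal matchings and the growth of the barrier.

  minimum : ∀ S fuel f → Match S f → missed f ≤ fuel → ∃ λ M → Match S M × (∀ g → Match S g → missed M ≤ missed g)
  minimum S fuel f mf h with ∃-function? (λ g → Match S g × missed g < missed f) (λ g → Match? S g ×-dec (missed g <? missed f))
    (λ { g g′ e (mg , l) → Match-resp S g g′ e mg , subst (_< missed f) (missed-resp g g′ e) l })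
  ... | no none = f , mf , λ g mg → ≮⇒≥ λ l → none (g , mg , l)
  minimum S zero       f mf h | yes (g , mg , l) = contradiction (≤-trans l h) λ ()
  minimum S (suc fuel) f mf h | yes (g , mg , l) = minimum S fuel g mg (s≤s⁻¹ (≤-trans l h))

  insert : Fin m → (Fin m → Bool) → Fin m → Bool
  insert v S t = does (t ≟ v) ∨ S t

  #-insert : ∀ {v S} → S v ≡ false → # (insert v S) ≡ suc (# S)
  #-insert {v} {S} Sv = trans (sum-cong pointwise) (trans (sum-+ m _ _) (cong (_+ # S) (sum-singleton v)))
    where
    pointwise : ∀ t → ind (insert v S t) 1 ≡ [ t ≟ v ] + ind (S t) 1
    pointwise t with t ≟ v
    ... | yes refl rewrite Sv = refl
    ... | no _ = refl

  same-parity : ∀ {a b h k} → a + (h + h) ≡ b + (k + k) → a < b → suc a < b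
  same-parity {a} {b} {h} {k} e a<b = ≤∧≢⇒< a<b λ { refl → even≢odd h k (begin
      2 * h ≡⟨ cong (h +_) (+-identityʳ h) ⟩
      h + h ≡⟨ +-cancelˡ-≡ a (h + h) (suc (k + k)) (trans e (sym (+-suc a (k + k)))) ⟩
      suc (k + k) ≡⟨ cong (λ x → suc (k + x)) (+-identityʳ k) ⟨
      suc (2 * k) ∎) }
    where open ≡-Reasoning

  -- Both counts have the parity of `m`, so a gap of one is a gap of two.
  missed-parity : ∀ {S f g} → Match S f → Match S g → missed f < missed g → suc (missed f) < missed g
  missed-parity {S} {f} {g} (invf , _) (invg , _) = same-parity {h = proj₁ pf} {k = proj₁ pg}
    (trans (sym (proj₂ pf)) (proj₂ pg))
    where
    pf = #-parity f invf (λ _ → true) (λ _ → refl)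
    pg = #-parity g invg (λ _ → true) (λ _ → refl)

  -- A vertex `v` that no optimal matching misses is moved into `S`. Matchings avoiding the larger
  -- set miss `v`, so they are not optimal for `S`, and by parity they miss at least two more
  -- vertices. This is just what `# S + # S` gains. When no such `v` is left, Gallai's lemma
  -- applies.
  grow : ∀ fuel S → m < fuel + # S → (∀ g → Match S g → # S + # S < missed g) → Barrier R
  grow zero       S h large = contradiction (#-≤ S) (<⇒≱ h)
  grow (suc fuel) S h large
    with M , mM , minimal ← minimum S (missed id) id ((λ _ → refl) , (λ _ → inj₁ refl) , (λ _ _ → refl)) ≤-refl
    with any? (λ v → (S v Bool.≟ false) ×-dec ¬? (Optimal.bothMissed? S (missed M) minimal v v))
  ... | yes (v , Sv , unmissable) = grow fuel (insert v S)
      (≤-trans h (≤-reflexive (sym (trans (cong (fuel +_) (#-insert Sv)) (+-suc fuel (# S))))))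
      large′
    where
    large′ : ∀ g → Match (insert v S) g → # (insert v S) + # (insert v S) < missed g
    large′ g (inv , adj , av) rewrite #-insert {v} {S} Sv | +-suc (# S) (# S) =
      ≤-trans (s≤s (s≤s (large M mM))) (missed-parity mM mg (≰⇒> λ le → unmissable (g , (mg , le) , gv , gv)))
      where
      gv : g v ≡ v
      gv = av v (cong (_∨ S v) (dec-true (v ≟ v) refl))
      mg : Match S g
      mg = inv , adj , λ t St → av t (trans (cong (does (t ≟ v) ∨_) St) (∨-zeroʳ _))
  ... | no all-missable = Optimal.AllMissable.barrier S (missed M) minimal M (mM , ≤-refl) missable (large M mM)
    where
    missable : ∀ v → S v ≡ false → ∃ λ f → Optimal.Opt S (missed M) minimal f × f v ≡ v
    missable v Sv with Optimal.bothMissed? S (missed M) minimal v v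
    ... | yes (f , o , fv , _) = f , o , fv
    ... | no h = contradiction (v , Sv , h) all-missable

  tutte : (∃ λ f → (∀ v → f (f v) ≡ v) × (∀ v → f v ≢ v) × (∀ v → R v (f v))) ⊎ Barrier R
  tutte with ∃-function? (λ f → Match (λ _ → false) f × missed f ≤ 0)
               (λ f → Match? (λ _ → false) f ×-dec (missed f ≤? 0))
               (λ f g e → λ { (mf , h) → Match-resp _ f g e mf , subst (_≤ 0) (missed-resp f g e) h })
  ... | no none = inj₂ (grow (suc m) (λ _ → false) (m≤m+n (suc m) _)
          (λ g mg → subst (λ x → x + x < missed g) (sym (sum-zero m)) (≰⇒> λ le → none (g , mg , le))))
  ... | yes (f , (inv , adj , _) , h) = inj₁ (f , inv , moved , λ v → [ (λ e → contradiction e (moved v)) , id ]′ (adj v))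
    where
    moved : ∀ v → f v ≢ v
    moved v e = contradiction (≤-trans (≤-reflexive (sym ([]-yes (f v ≟ v) e))) (≤-trans (sum-≥ (λ v → [ f v ≟ v ]) v) h)) λ ()

-- Projections

ind-positive : ∀ {P : Set} {k} (p? : Dec P) → 1 ≤ ind (does p?) k → P × 1 ≤ k
ind-positive (yes p) h = p , h

endpoint : (E : Ends n) → ∃ λ v → 1 ≤ mult v E
endpoint (nrm x y) = x , ≤-trans (≤-reflexive (sym ([]-yes (x ≟ x) refl))) (m≤m+n _ _)
endpoint (lp x)    = x , ≤-trans (s≤s z≤n) (≤-reflexive (sym (cong (λ b → ind b 2) (dec-true (x ≟ x) refl))))
endpoint (sm x)    = x , ≤-reflexive (sym ([]-yes (x ≟ x) refl))

-- Every edge of `H` has an end, and the local condition there yields a preimage. Summing the local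
-- condition over the edges of `H` gives the degrees.
local⇒projection : ∀ {b} (G H : Graph) (fV : Fin (nV G) → Fin (nV H)) (fE : Fin (nE G) → Fin (nE H)) →
  Surjective fV → (∀ e → EdgeMap fV b (ends G e) (ends H (fE e))) →
  (∀ v h → sumFin (nE G) (λ e → ind (does (fE e ≟ h)) (mult v (ends G e))) ≡ mult (fV v) (ends H h)) →
  IsProjection b G H fV fE
local⇒projection G H fV fE sV em loc = record
  { surjV = sV ; surjE = sE ; degPres = degrees ; edgeMap = em ; local = loc }
  where
  sE : Surjective fE
  sE h with v , p ← endpoint (ends H h) with x , refl ← sV v
       with e , q ← sum-positive _ (≤-trans p (≤-reflexive (sym (loc x h)))) = e , proj₁ (ind-positive (fE e ≟ h) q)
  degrees : ∀ v → deg G v ≡ deg H (fV v)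
  degrees v = begin
    deg G v
      ≡⟨ sum-cong (λ e → sum-δ (fE e) (λ _ → mult v (ends G e))) ⟨
    sumFin (nE G) (λ e → sumFin (nE H) (λ h → ind (does (fE e ≟ h)) (mult v (ends G e))))
      ≡⟨ sum-swap (nE G) (nE H) _ ⟩
    sumFin (nE H) (λ h → sumFin (nE G) (λ e → ind (does (fE e ≟ h)) (mult v (ends G e))))
      ≡⟨ sum-cong (loc v) ⟩
    deg H (fV v) ∎
    where open ≡-Reasoning

-- Only semi-edges can use the exception `sl`. A normal edge lying over a semi-edge that is sent to
-- a loop falls under `nl`, so the composite is an ordinary covering.
edgeMap-∘ : ∀ {n m k b b′} {g : Fin n → Fin m} {f : Fin m → Fin k} {x y E E′} →
  EdgeMap g false (nrm x y) E → EdgeMap f b E E′ → EdgeMap (f ∘ g) b′ (nrm x y) E′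
edgeMap-∘ (nn refl refl)  (nn p q)  = nn p q
edgeMap-∘ (nn refl refl)  (nn' p q) = nn' p q
edgeMap-∘ (nn refl refl)  (nl p q)  = nl p q
edgeMap-∘ (nn refl refl)  (ns p q)  = ns p q
edgeMap-∘ (nn' refl refl) (nn p q)  = nn' q p
edgeMap-∘ (nn' refl refl) (nn' p q) = nn q p
edgeMap-∘ (nn' refl refl) (nl p q)  = nl q p
edgeMap-∘ (nn' refl refl) (ns p q)  = ns q p
edgeMap-∘ {f = f} (nl p q) (ll r) = nl (trans (cong f p) r) (trans (cong f q) r)
edgeMap-∘ {f = f} (ns p q) (ss r) = ns (trans (cong f p) r) (trans (cong f q) r)
edgeMap-∘ {f = f} (ns p q) (sl r) = nl (trans (cong f p) r) (trans (cong f q) r)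

semiCovers⇒▷ : ∀ A H → SemiCovers A H → A ▷ H
semiCovers⇒▷ A H (fV , fE , f) G (normal , _) (gV , gE , g) = fV ∘ gV , fE ∘ gE ,
  local⇒projection G H (fV ∘ gV) (fE ∘ gE) surjective edges loc
  where
  module f = IsProjection f
  module g = IsProjection g
  surjective : Surjective (fV ∘ gV)
  surjective z with y , refl ← f.surjV z with x , refl ← g.surjV y = x , refl
  edges : ∀ e → EdgeMap (fV ∘ gV) false (ends G e) (ends H (fE (gE e)))
  edges e with x , y , eq ← normal e | p ← g.edgeMap e rewrite eq = edgeMap-∘ p (f.edgeMap (gE e))
  loc : ∀ v h → sumFin (nE G) (λ e → ind (does (fE (gE e) ≟ h)) (mult v (ends G e))) ≡ mult (fV (gV v)) (ends H h)
  loc v h = begin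
    sumFin (nE G) (λ e → ind (does (fE (gE e) ≟ h)) (mult v (ends G e)))
      ≡⟨ sum-cong (λ e → sum-δ (gE e) (λ a → ind (does (fE a ≟ h)) (mult v (ends G e)))) ⟨
    sumFin (nE G) (λ e → sumFin (nE A) (λ a → ind (does (gE e ≟ a)) (ind (does (fE a ≟ h)) (mult v (ends G e)))))
      ≡⟨ sum-swap (nE G) (nE A) _ ⟩
    sumFin (nE A) (λ a → sumFin (nE G) (λ e → ind (does (gE e ≟ a)) (ind (does (fE a ≟ h)) (mult v (ends G e)))))
      ≡⟨ sum-cong (λ a → trans (sum-cong λ e → ind-swap (does (gE e ≟ a)) (does (fE a ≟ h)) (mult v (ends G e))) (sum-ind (nE G) (does (fE a ≟ h)) _)) ⟩
    sumFin (nE A) (λ a → ind (does (fE a ≟ h)) (sumFin (nE G) (λ e → ind (does (gE e ≟ a)) (mult v (ends G e)))))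
      ≡⟨ sum-cong (λ a → cong (ind (does (fE a ≟ h))) (g.local v a)) ⟩
    sumFin (nE A) (λ a → ind (does (fE a ≟ h)) (mult (gV v) (ends A a)))
      ≡⟨ f.local (gV v) h ⟩
    mult (fV (gV v)) (ends H h) ∎
    where open ≡-Reasoning

-- Lifts of multigraphs

Joins : ∀ {n m} → (Fin n → Fin m) → (Fin n → Fin m) → Fin m → Fin m → Set
Joins src tgt u v = ∃ λ e → (src e ≡ u × tgt e ≡ v) ⊎ (src e ≡ v × tgt e ≡ u)

does-≟-combine : ∀ {m} κ (x : Fin (m * κ)) w k →
  does (x ≟ combine w k) ≡ does (quotient {m} κ x ≟ w) ∧ does (remainder {m} κ x ≟ k)
does-≟-combine {m} κ x w k = []-⇔ (x ≟ combine w k) ((quotient {m} κ x ≟ w) ×-dec (remainder {m} κ x ≟ k))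
  (λ { refl → ,-injective (remQuot-combine w k) })
  (λ { (p , q) → trans (sym (combine-remQuot {m} κ x)) (cong₂ combine p q) })

-- The permutation voltage lift: on sheet `k`, the edge `e` runs from `k` over `src e` to `ρ e k`
-- over `tgt e`. The base may have loops and parallel edges; `distinct` makes the lifts of loops
-- normal edges.
module Lift {ε m κ : ℕ} (src tgt : Fin ε → Fin m) (ρ σ : Fin ε → Fin κ → Fin κ)
            (σρ : ∀ e k → σ e (ρ e k) ≡ k) (ρσ : ∀ e k → ρ e (σ e k) ≡ k)
            (distinct : ∀ e k → src e ≡ tgt e → ρ e k ≢ k) where

  edge : Fin (ε * κ) → Fin ε
  edge = quotient κ

  sheet : Fin (ε * κ) → Fin κ
  sheet = remainder {ε} κ

  liftSrc liftTgt : Fin (ε * κ) → Fin (m * κ)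
  liftSrc e = combine (src (edge e)) (sheet e)
  liftTgt e = combine (tgt (edge e)) (ρ (edge e) (sheet e))

  lift : Graph
  lift = record
    { nV = m * κ ; nE = ε * κ ; ends = λ e → nrm (liftSrc e) (liftTgt e)
    ; nrm-distinct = λ { e _ _ refl eq →
        let p , q = combine-injective _ _ _ _ eq in distinct (edge e) (sheet e) p (sym q) } }

  edge-ext : ∀ {e e′} → edge e ≡ edge e′ → sheet e ≡ sheet e′ → e ≡ e′
  edge-ext {e} {e′} p q =
    trans (sym (combine-remQuot {ε} κ e)) (trans (cong₂ combine p q) (combine-remQuot {ε} κ e′))

  -- The second hypothesis includes `e ≡ e′`: a 2-cycle in the permutation of a loop would lift to
  -- two parallel edges.
  lift-simple :
    (∀ e e′ k → src e ≡ src e′ → tgt e ≡ tgt e′ → ρ e k ≡ ρ e′ k → e ≡ e′) →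
    (∀ e e′ k → src e ≡ tgt e′ → tgt e ≡ src e′ → ρ e (ρ e′ k) ≢ k) →
    Simple lift
  lift-simple parallel antiparallel = (λ e → _ , _ , refl) , unique
    where
    unique : ∀ e e′ x y u v → ends lift e ≡ nrm x y → ends lift e′ ≡ nrm u v →
      (x ≡ u × y ≡ v) ⊎ (x ≡ v × y ≡ u) → e ≡ e′
    unique e e′ _ _ _ _ refl refl (inj₁ (p , q))
      with s , k ← combine-injective (src (edge e)) (sheet e) (src (edge e′)) (sheet e′) p
         | t , l ← combine-injective (tgt (edge e)) (ρ (edge e) (sheet e)) (tgt (edge e′)) (ρ (edge e′) (sheet e′)) q
      = edge-ext (parallel _ _ (sheet e) s t (trans l (cong (ρ (edge e′)) (sym k)))) k
    unique e e′ _ _ _ _ refl refl (inj₂ (p , q))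
      with s , k ← combine-injective (src (edge e)) (sheet e) (tgt (edge e′)) (ρ (edge e′) (sheet e′)) p
         | t , l ← combine-injective (tgt (edge e)) (ρ (edge e) (sheet e)) (src (edge e′)) (sheet e′) q
      = contradiction (trans (cong (ρ (edge e)) (sym k)) l) (antiparallel _ _ (sheet e′) s t)

  sum-over-fibre : ∀ x w (π τ : Fin κ → Fin κ) → (∀ k → τ (π k) ≡ k) → (∀ k → π (τ k) ≡ k) →
    sumFin κ (λ k → [ x ≟ combine w (π k) ]) ≡ [ quotient {m} κ x ≟ w ]
  sum-over-fibre x w π τ τπ πτ = begin
    sumFin κ (λ k → [ x ≟ combine w (π k) ])
      ≡⟨ sum-cong (λ k → trans (cong (λ b → ind b 1) (does-≟-combine κ x w (π k))) (sym (ind-ind (does (quotient {m} κ x ≟ w)) _ 1))) ⟩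
    sumFin κ (λ k → ind (does (quotient {m} κ x ≟ w)) [ remainder {m} κ x ≟ π k ])
      ≡⟨ sum-ind κ (does (quotient {m} κ x ≟ w)) _ ⟩
    ind (does (quotient {m} κ x ≟ w)) (sumFin κ (λ k → [ remainder {m} κ x ≟ π k ]))
      ≡⟨ cong (ind (does (quotient {m} κ x ≟ w))) (trans (sum-bij π τ τπ πτ _) (sum-δ (remainder {m} κ x) (λ _ → 1))) ⟩
    [ quotient {m} κ x ≟ w ] ∎
    where open ≡-Reasoning

  lift-local : ∀ x e → sumFin κ (λ k → mult x (ends lift (combine e k))) ≡
    [ quotient {m} κ x ≟ src e ] + [ quotient {m} κ x ≟ tgt e ]
  lift-local x e = begin
    sumFin κ (λ k → mult x (ends lift (combine e k)))
      ≡⟨ sum-cong (λ k → cong (mult x) (ends-combine k)) ⟩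
    sumFin κ (λ k → [ x ≟ combine (src e) k ] + [ x ≟ combine (tgt e) (ρ e k) ])
      ≡⟨ sum-+ κ _ _ ⟩
    sumFin κ (λ k → [ x ≟ combine (src e) k ]) + sumFin κ (λ k → [ x ≟ combine (tgt e) (ρ e k) ])
      ≡⟨ cong₂ _+_ (sum-over-fibre x (src e) id id (λ _ → refl) (λ _ → refl))
                   (sum-over-fibre x (tgt e) (ρ e) (σ e) (σρ e) (ρσ e)) ⟩
    [ quotient {m} κ x ≟ src e ] + [ quotient {m} κ x ≟ tgt e ] ∎
    where
    open ≡-Reasoning
    ends-combine : ∀ k → ends lift (combine e k) ≡ nrm (combine (src e) k) (combine (tgt e) (ρ e k))
    ends-combine k = cong (λ p → nrm (combine (src (proj₁ p)) (proj₂ p)) (combine (tgt (proj₁ p)) (ρ (proj₁ p) (proj₂ p))))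
                          (remQuot-combine e k)

-- The double of a graph consists of two copies of it in which each semi-edge
-- is replaced by a single edge between the two copies of its vertex.

arity : Ends n → ℕ
arity (nrm _ _) = 2
arity (lp _)    = 2
arity (sm _)    = 1

doubleSrc doubleTgt : (E : Ends n) → Fin (arity E) → Fin (n * 2)
doubleSrc (nrm x y) p = combine x p
doubleSrc (lp x)    p = combine x p
doubleSrc (sm x)    p = combine x zero
doubleTgt (nrm x y) p = combine y p
doubleTgt (lp x)    p = combine x p
doubleTgt (sm x)    p = combine x (suc zero)

double-local : (E : Ends n) (w : Fin (n * 2)) →
  sumFin (arity E) (λ p → [ w ≟ doubleSrc E p ] + [ w ≟ doubleTgt E p ]) ≡ mult (quotient {n} 2 w) E
double-local {n} E w = go E
  where
  v = quotient {n} 2 w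
  one : ∀ x → [ w ≟ combine x zero ] + [ w ≟ combine x (suc zero) ] ≡ [ v ≟ x ]
  one x rewrite does-≟-combine 2 w x zero | does-≟-combine 2 w x (suc zero) with does (v ≟ x) | remainder {n} 2 w
  ... | true  | zero     = refl
  ... | true  | suc zero = refl
  ... | false | _        = refl
  two : ∀ x y → ([ w ≟ combine x zero ] + [ w ≟ combine y zero ]) +
    (([ w ≟ combine x (suc zero) ] + [ w ≟ combine y (suc zero) ]) + 0) ≡ [ v ≟ x ] + [ v ≟ y ]
  two x y = trans (cong (([ w ≟ combine x zero ] + [ w ≟ combine y zero ]) +_) (+-identityʳ _))
                  (trans (+-interchange [ w ≟ combine x zero ] _ _ _) (cong₂ _+_ (one x) (one y)))
  go : ∀ E → sumFin (arity E) (λ p → [ w ≟ doubleSrc E p ] + [ w ≟ doubleTgt E p ]) ≡ mult v E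
  go (nrm x y) = two x y
  go (lp x) = trans (two x x) (lemma (does (v ≟ x)))
    where
    lemma : ∀ b → ind b 1 + ind b 1 ≡ ind b 2
    lemma true = refl
    lemma false = refl
  go (sm x) = trans (+-identityʳ _) (one x)

double-edgeMap : ∀ {n l} (E : Ends n) p (f : Fin l → Fin n) {x y} →
  f x ≡ quotient {n} 2 (doubleSrc E p) → f y ≡ quotient {n} 2 (doubleTgt E p) → EdgeMap f false (nrm x y) E
double-edgeMap (nrm a b) p f r s =
  nn (trans r (cong proj₁ (remQuot-combine a p))) (trans s (cong proj₁ (remQuot-combine b p)))
double-edgeMap (lp a) p f r s =
  nl (trans r (cong proj₁ (remQuot-combine a p))) (trans s (cong proj₁ (remQuot-combine a p)))
double-edgeMap {n} (sm a) p f r s =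
  ns (trans r (cong proj₁ (remQuot-combine {n} {2} a zero))) (trans s (cong proj₁ (remQuot-combine {n} {2} a (suc zero))))

module Double (A : Graph) where

  arities : Fin (nE A) → ℕ
  arities e = arity (ends A e)

  ε = sumFin (nE A) arities

  base : Fin ε → Fin (nE A)
  base e = proj₁ (split arities e)

  src tgt : Fin ε → Fin (nV A * 2)
  src e = doubleSrc (ends A (base e)) (proj₂ (split arities e))
  tgt e = doubleTgt (ends A (base e)) (proj₂ (split arities e))

  module _ {κ : ℕ} (k₀ : Fin κ) (ρ σ : Fin ε → Fin κ → Fin κ)
           (σρ : ∀ e k → σ e (ρ e k) ≡ k) (ρσ : ∀ e k → ρ e (σ e k) ≡ k)
           (distinct : ∀ e k → src e ≡ tgt e → ρ e k ≢ k) where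
    open Lift src tgt ρ σ σρ ρσ distinct

    lift-covers : Covers lift A
    lift-covers = fV , fE , local⇒projection lift A fV fE
      (λ v → combine (combine v zero) k₀ , trans (cong (quotient {nV A} 2 ∘ proj₁) (remQuot-combine (combine v zero) k₀)) (cong proj₁ (remQuot-combine {nV A} {2} v zero)))
      (λ e → double-edgeMap (ends A (fE e)) _ fV
        (cong (quotient {nV A} 2 ∘ proj₁) (remQuot-combine (src (edge e)) (sheet e)))
        (cong (quotient {nV A} 2 ∘ proj₁) (remQuot-combine (tgt (edge e)) (ρ (edge e) (sheet e)))))
      loc
      where
      fV : Fin (nV A * 2 * κ) → Fin (nV A)
      fV x = quotient {nV A} 2 (quotient {nV A * 2} κ x)
      fE : Fin (ε * κ) → Fin (nE A)
      fE e = base (edge e)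
      loc : ∀ x h → sumFin (ε * κ) (λ e → ind (does (fE e ≟ h)) (mult x (ends lift e))) ≡ mult (fV x) (ends A h)
      loc x h = begin
        sumFin (ε * κ) (λ e → ind (does (fE e ≟ h)) (mult x (ends lift e)))
          ≡⟨ sum-combine ε κ _ ⟩
        sumFin ε (λ e → sumFin κ (λ k → ind (does (base (edge (combine e k)) ≟ h)) (mult x (ends lift (combine e k)))))
          ≡⟨ sum-cong (λ e → trans
               (sum-cong λ k → cong (λ p → ind (does (base (proj₁ p) ≟ h)) (mult x (ends lift (combine e k)))) (remQuot-combine e k))
               (sum-ind κ (does (base e ≟ h)) _)) ⟩
        sumFin ε (λ e → ind (does (base e ≟ h)) (sumFin κ (λ k → mult x (ends lift (combine e k)))))
          ≡⟨ sum-cong (λ e → cong (ind (does (base e ≟ h))) (lift-local x e)) ⟩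
        sumFin ε (λ e → ind (does (base e ≟ h)) ([ w ≟ src e ] + [ w ≟ tgt e ]))
          ≡⟨ sum-split arities (λ { (e , p) → ind (does (e ≟ h)) ([ w ≟ doubleSrc (ends A e) p ] + [ w ≟ doubleTgt (ends A e) p ]) }) ⟩
        sumFin (nE A) (λ e → sumFin (arities e) (λ p → ind (does (e ≟ h)) ([ w ≟ doubleSrc (ends A e) p ] + [ w ≟ doubleTgt (ends A e) p ])))
          ≡⟨ sum-cong (λ e → trans (sum-ind (arities e) (does (e ≟ h)) _) (cong (ind (does (e ≟ h))) (double-local (ends A e) w))) ⟩
        sumFin (nE A) (λ e → ind (does (e ≟ h)) (mult (fV x) (ends A e)))
          ≡⟨ sum-δ′ h _ ⟩
        mult (fV x) (ends A h) ∎
        where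
        open ≡-Reasoning
        w = quotient {nV A * 2} κ x
*-ind : ∀ c b k → c * ind b k ≡ ind b (c * k)
*-ind c true  k = refl
*-ind c false k = *-zeroʳ c

sum-* : ∀ n c (f : Fin n → ℕ) → sumFin n (λ i → c * f i) ≡ c * sumFin n f
sum-* zero    c f = sym (*-zeroʳ c)
sum-* (suc n) c f = trans (cong (c * f zero +_) (sum-* n c (f ∘ suc))) (sym (*-distribˡ-+ c _ _))

-- The fibre of the cover destroying perfect matchings

rot : ℕ → ∀ n → Fin n → Fin n
rot s (suc n) t = fromℕ< (m%n<n (toℕ t + s) (suc n))

toℕ-rot : ∀ s n (t : Fin (suc n)) → toℕ (rot s (suc n) t) ≡ (toℕ t + s) % suc n
toℕ-rot s n t = toℕ-fromℕ< (m%n<n (toℕ t + s) (suc n))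

rot-rot : ∀ a b n (t : Fin n) → rot a n (rot b n t) ≡ rot (b + a) n t
rot-rot a b (suc n) t = toℕ-injective (begin
  toℕ (rot a (suc n) (rot b (suc n) t)) ≡⟨ toℕ-rot a n (rot b (suc n) t) ⟩
  (toℕ (rot b (suc n) t) + a) % suc n   ≡⟨ cong (λ x → (x + a) % suc n) (toℕ-rot b n t) ⟩
  ((toℕ t + b) % suc n + a) % suc n     ≡⟨ %-distribˡ-+ ((toℕ t + b) % suc n) a (suc n) ⟩
  ((toℕ t + b) % suc n % suc n + a % suc n) % suc n
    ≡⟨ cong (λ x → (x + a % suc n) % suc n) (m%n%n≡m%n (toℕ t + b) (suc n)) ⟩
  ((toℕ t + b) % suc n + a % suc n) % suc n ≡⟨ %-distribˡ-+ (toℕ t + b) a (suc n) ⟨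
  (toℕ t + b + a) % suc n               ≡⟨ cong (_% suc n) (+-assoc (toℕ t) b a) ⟩
  (toℕ t + (b + a)) % suc n             ≡⟨ toℕ-rot (b + a) n t ⟨
  toℕ (rot (b + a) (suc n) t)           ∎)
  where open ≡-Reasoning

rot-period : ∀ j n (t : Fin n) → rot (j * n) n t ≡ t
rot-period j (suc n) t = toℕ-injective (begin
  toℕ (rot (j * suc n) (suc n) t) ≡⟨ toℕ-rot (j * suc n) n t ⟩
  (toℕ t + j * suc n) % suc n     ≡⟨ [m+kn]%n≡m%n (toℕ t) j (suc n) ⟩
  toℕ t % suc n                   ≡⟨ m<n⇒m%n≡m (toℕ<n t) ⟩
  toℕ t                           ∎)
  where open ≡-Reasoning

-- Together with a rotation by `s` this makes `s` full turns, so the inverse is again a rotation.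
unrot : ℕ → ∀ n → Fin n → Fin n
unrot s n = rot (s * pred n) n

rot-unrot : ∀ s n (t : Fin n) → rot s n (unrot s n t) ≡ t
rot-unrot s n@(suc l) t = trans (rot-rot s (s * l) n t)
  (trans (cong (λ d → rot d n t) (trans (+-comm (s * l) s) (sym (*-suc s l)))) (rot-period s n t))

unrot-rot : ∀ s n (t : Fin n) → unrot s n (rot s n t) ≡ t
unrot-rot s n@(suc l) t = trans (rot-rot (s * l) s n t)
  (trans (cong (λ d → rot d n t) (sym (*-suc s l))) (rot-period s n t))

rot-free : ∀ d n (t : Fin n) → 0 < d → d < n → rot d n t ≢ t
rot-free d n@(suc l) t 0<d d<n eq with toℕ t + d <? n
... | yes lt = <⇒≢ (m<m+n (toℕ t) 0<d) (sym (begin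
  toℕ t + d         ≡⟨ m<n⇒m%n≡m lt ⟨
  (toℕ t + d) % n   ≡⟨ toℕ-rot d l t ⟨
  toℕ (rot d n t)   ≡⟨ cong toℕ eq ⟩
  toℕ t             ∎))
  where open ≡-Reasoning
... | no ge = <⇒≢ d<n (+-cancelˡ-≡ (toℕ t) d n (begin
  toℕ t + d                 ≡⟨ m∸n+n≡m (≮⇒≥ ge) ⟨
  toℕ t + d ∸ n + n         ≡⟨ cong (_+ n) wrapped ⟨
  toℕ t + n                 ∎))
  where
  open ≡-Reasoning
  small : toℕ t + d ∸ n < n
  small = +-cancelʳ-< n _ _ (≤-trans (s≤s (≤-reflexive (m∸n+n≡m (≮⇒≥ ge)))) (+-mono-< (toℕ<n t) d<n))
  wrapped : toℕ t ≡ toℕ t + d ∸ n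
  wrapped = begin
    toℕ t                 ≡⟨ cong toℕ eq ⟨
    toℕ (rot d n t)       ≡⟨ toℕ-rot d l t ⟩
    (toℕ t + d) % n       ≡⟨ m≤n⇒[n∸m]%m≡n%m (≮⇒≥ ge) ⟨
    (toℕ t + d ∸ n) % n   ≡⟨ m<n⇒m%n≡m small ⟩
    toℕ t + d ∸ n         ∎

rot-< : ∀ a b n (t : Fin n) → a < b → b < n → rot b n t ≢ rot a n t
rot-< a b n t a<b b<n e = rot-free (b ∸ a) n (rot a n t) (m<n⇒0<n∸m a<b) (≤-trans (s≤s (m∸n≤m b a)) b<n)
  (trans (rot-rot (b ∸ a) a n t) (trans (cong (λ d → rot d n t) (m+[n∸m]≡n (<⇒≤ a<b))) e))

rot-injective : ∀ a b n (t : Fin n) → a < n → b < n → rot a n t ≡ rot b n t → a ≡ b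
rot-injective a b n t a<n b<n eq with <-cmp a b
... | tri≈ _ e _   = e
... | tri< a<b _ _ = contradiction (sym eq) (rot-< a b n t a<b b<n)
... | tri> _ _ b<a = contradiction eq (rot-< b a n t b<a a<n)

-- Permutations of the fibre made up of rotations.

data Fibre (m N : ℕ) : Set where
  core : Fin N → Fibre m N
  sat  : Fin N → Fin m → Fin N → Fibre m N

module Coding (m N : ℕ) where

  satellite : Fin N × Fin (m * N) → Fibre m N
  satellite (i , jt) = sat i (quotient {m} N jt) (remainder {m} N jt)

  decode : Fin (N + N * (m * N)) → Fibre m N
  decode k = [ core , satellite ∘ remQuot {N} (m * N) ]′ (splitAt N k)

  encode : Fibre m N → Fin (N + N * (m * N))
  encode (core i) = i ↑ˡ (N * (m * N))
  encode (sat i j t) = N ↑ʳ combine i (combine j t)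

  decode-encode : ∀ k → decode (encode k) ≡ k
  decode-encode (core i) rewrite splitAt-↑ˡ N i (N * (m * N)) = refl
  decode-encode (sat i j t) = begin
    decode (N ↑ʳ combine i (combine j t))
      ≡⟨ cong [ core , satellite ∘ remQuot {N} (m * N) ]′ (splitAt-↑ʳ N (N * (m * N)) (combine i (combine j t))) ⟩
    satellite (remQuot {N} (m * N) (combine i (combine j t)))
      ≡⟨ cong satellite (remQuot-combine i (combine j t)) ⟩
    satellite (i , combine j t)
      ≡⟨ cong (λ p → sat i (proj₁ p) (proj₂ p)) (remQuot-combine j t) ⟩
    sat i j t ∎
    where open ≡-Reasoning

  encode-decode : ∀ k → encode (decode k) ≡ k
  encode-decode k with splitAt N k in eq
  ... | inj₁ i = splitAt⁻¹-↑ˡ eq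
  ... | inj₂ r = trans (cong (N ↑ʳ_) (trans (cong (combine (quotient {N} (m * N) r)) (combine-remQuot {m} N (remainder {N} (m * N) r))) (combine-remQuot {N} (m * N) r))) (splitAt⁻¹-↑ʳ eq)

  sum-decode : ∀ f → sumFin (N + N * (m * N)) (f ∘ decode) ≡
    sumFin N (λ i → f (core i)) + sumFin N (λ i → sumFin m (λ j → sumFin N (λ t → f (sat i j t))))
  sum-decode f = trans (sum-↑ N _ _) (cong₂ _+_
    (sum-cong λ i → cong f (decode-encode (core i)))
    (trans (sum-combine N (m * N) _) (sum-cong λ i → trans (sum-combine m N _)
      (sum-cong λ j → sum-cong λ t → cong f (decode-encode (sat i j t))))))

  cycle : Fin N → Fin m → Fin (suc N) → Fibre m N
  cycle i j zero    = core i
  cycle i j (suc t) = sat i j t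

  -- The label `nothing` is for edges meeting `S`: they turn the cores among themselves, so a core
  -- copy of a class sees only core copies of `S`. The label `just j` is for edges inside the class
  -- `j`: they insert `core i` into the block `sat i j`, a cycle of length `suc N`. All other blocks
  -- turn by themselves.
  act : Maybe (Fin m) → (∀ n → Fin n → Fin n) → Fibre m N → Fibre m N
  act nothing  g (core i)     = core (g N i)
  act nothing  g (sat i j t)  = sat i j (g N t)
  act (just j) g (core i)     = cycle i j (g (suc N) zero)
  act (just j) g (sat i j′ t) = if does (j′ ≟ j) then cycle i j (g (suc N) (suc t)) else sat i j′ (g N t)

  act-cycle : ∀ j g i t → act (just j) g (cycle i j t) ≡ cycle i j (g (suc N) t)
  act-cycle j g i zero = refl
  act-cycle j g i (suc t) rewrite dec-true (j ≟ j) refl = refl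

  act-inverse : ∀ ℓ g h → (∀ n t → g n (h n t) ≡ t) → ∀ k → act ℓ g (act ℓ h k) ≡ k
  act-inverse nothing  g h gh (core i)    = cong core (gh N i)
  act-inverse nothing  g h gh (sat i j t) = cong (sat i j) (gh N t)
  act-inverse (just j) g h gh (core i) = trans (act-cycle j g i _) (cong (cycle i j) (gh (suc N) zero))
  act-inverse (just j) g h gh (sat i j′ t) with j′ ≟ j in eq
  ... | yes refl = trans (act-cycle j g i _) (cong (cycle i j) (gh (suc N) (suc t)))
  ... | no _ rewrite eq = cong (sat i j′) (gh N t)

  cycle-injective : ∀ {i j t t′} → cycle i j t ≡ cycle i j t′ → t ≡ t′
  cycle-injective {t = zero}  {zero}   eq = refl
  cycle-injective {t = suc t} {suc .t} refl = refl

  core-injective : ∀ {i i′} → core {m} {N} i ≡ core i′ → i ≡ i′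
  core-injective refl = refl

  sat-injective : ∀ {i j t t′} → sat {m} {N} i j t ≡ sat i j t′ → t ≡ t′
  sat-injective refl = refl

  -- Every point lies on a cycle of length `N` or `suc N` on which `act` is the given map.
  -- Simplicity of the lift thus becomes a question about rotations.
  act-separates : ∀ ℓ g h k → act ℓ g k ≡ act ℓ h k → ∃ λ n → N ≤ n × ∃ λ t → g n t ≡ h n t
  act-separates nothing  g h (core i)    eq = N , ≤-refl , i , core-injective eq
  act-separates nothing  g h (sat i j t) eq = N , ≤-refl , t , sat-injective eq
  act-separates (just j) g h (core i)    eq = suc N , n≤1+n N , zero , cycle-injective eq
  act-separates (just j) g h (sat i j′ t) eq with j′ ≟ j
  ... | yes refl = suc N , n≤1+n N , suc t , cycle-injective eq
  ... | no _ = N , ≤-refl , t , sat-injective eq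

  act-∘ : ∀ ℓ g h k → act ℓ g (act ℓ h k) ≡ act ℓ (λ n → g n ∘ h n) k
  act-∘ nothing  g h (core i)    = refl
  act-∘ nothing  g h (sat i j t) = refl
  act-∘ (just j) g h (core i) = act-cycle j g i _
  act-∘ (just j) g h (sat i j′ t) with j′ ≟ j in eq
  ... | yes refl = act-cycle j g i _
  ... | no _ rewrite eq = refl

  act-id : ∀ ℓ k → act ℓ (λ n → id) k ≡ k
  act-id ℓ k = trans (sym (act-∘ ℓ (λ n → id) (λ n → id) k)) (act-inverse ℓ (λ n → id) (λ n → id) (λ n t → refl) k)

-- Over a vertex of the class C_z, core i is the extra copy of C_z in the i-th
-- piece of z; over S, the elements core i are the N copies of S. The remaining
-- vertices (w , sat i z t) fill up the i-th piece of z. All cycles of the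
-- voltages have length at least N > 2ε, which makes the lift simple.
module BarrierLift (A : Graph) (S : Fin (nV A * 2) → Bool) (c : Fin (nV A * 2) → Fin (nV A * 2))
                   (sep : ∀ {u v} → Joins (Double.src A) (Double.tgt A) u v → S u ≡ false → S v ≡ false → c u ≡ c v) where

  open Double A

  V N κ : ℕ
  V = nV A * 2
  N = suc (ε + ε)
  κ = N + N * (V * N)

  open Coding V N

  lab : Fin V → Fin V → Maybe (Fin V)
  lab u v = if S u ∨ S v then nothing else just (c u)

  lab-sym : ∀ {u v} → Joins src tgt u v → lab u v ≡ lab v u
  lab-sym {u} {v} j with S u in p | S v in q
  ... | true  | true  = refl
  ... | true  | false = refl
  ... | false | true  = refl
  ... | false | false = cong just (sep j p q)

  -- Positive, so no lifted edge closes up; pairwise different, so parallel edges have different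
  -- lifts; at most `ε`, so two voltages add up to less than `N` and antiparallel edges cannot
  -- cancel.
  voltage : Fin ε → ℕ
  voltage e = suc (toℕ e)

  level : Fin ε → Maybe (Fin V)
  level e = lab (src e) (tgt e)

  ρ σ : Fin ε → Fin κ → Fin κ
  ρ e k = encode (act (level e) (rot (voltage e)) (decode k))
  σ e k = encode (act (level e) (unrot (voltage e)) (decode k))

  decode-ρ : ∀ e k → decode (ρ e k) ≡ act (level e) (rot (voltage e)) (decode k)
  decode-ρ e k = decode-encode _

  inverse : ∀ ℓ g h → (∀ n t → g n (h n t) ≡ t) → ∀ k →
    encode (act ℓ g (decode (encode (act ℓ h (decode k))))) ≡ k
  inverse ℓ g h gh k = trans (cong (encode ∘ act ℓ g) (decode-encode _))
    (trans (cong encode (act-inverse ℓ g h gh (decode k))) (encode-decode k))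

  σρ : ∀ e k → σ e (ρ e k) ≡ k
  σρ e = inverse (level e) (unrot (voltage e)) (rot (voltage e)) (unrot-rot (voltage e))

  ρσ : ∀ e k → ρ e (σ e k) ≡ k
  ρσ e = inverse (level e) (rot (voltage e)) (unrot (voltage e)) (rot-unrot (voltage e))

  voltage<N : ∀ e → voltage e < N
  voltage<N e = s≤s (≤-trans (toℕ<n e) (m≤m+n ε ε))

  distinct : ∀ e k → src e ≡ tgt e → ρ e k ≢ k
  distinct e k _ eq
    with n , N≤n , t , fix ← act-separates (level e) (rot (voltage e)) (λ n → id) (decode k)
           (trans (sym (decode-ρ e k)) (trans (cong decode eq) (sym (act-id (level e) (decode k)))))
    = rot-free (voltage e) n t (s≤s z≤n) (≤-trans (voltage<N e) N≤n) fix

  open Lift src tgt ρ σ σρ ρσ distinct public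

  covers : Covers lift A
  covers = lift-covers (zero {ε + ε + N * (V * N)}) ρ σ σρ ρσ distinct

  simple : Simple lift
  simple = lift-simple parallel antiparallel
    where
    parallel : ∀ e e′ k → src e ≡ src e′ → tgt e ≡ tgt e′ → ρ e k ≡ ρ e′ k → e ≡ e′
    parallel e e′ k s t eq
      with n , N≤n , r , same ← act-separates (level e) (rot (voltage e)) (rot (voltage e′)) (decode k)
             (trans (sym (decode-ρ e k)) (trans (cong decode eq) (trans (decode-ρ e′ k)
               (cong (λ ℓ → act ℓ (rot (voltage e′)) (decode k)) (sym (cong₂ lab s t))))))
      = toℕ-injective (suc-injective (rot-injective _ _ n r (≤-trans (voltage<N e) N≤n) (≤-trans (voltage<N e′) N≤n) same))
    composite : ∀ e e′ k → src e ≡ tgt e′ → tgt e ≡ src e′ →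
      act (level e) (λ n → rot (voltage e) n ∘ rot (voltage e′) n) (decode k) ≡ decode (ρ e (ρ e′ k))
    composite e e′ k s t = begin
      act (level e) (λ n → rot (voltage e) n ∘ rot (voltage e′) n) (decode k)
        ≡⟨ act-∘ (level e) (rot (voltage e)) (rot (voltage e′)) (decode k) ⟨
      act (level e) (rot (voltage e)) (act (level e) (rot (voltage e′)) (decode k))
        ≡⟨ cong (λ ℓ → act (level e) (rot (voltage e)) (act ℓ (rot (voltage e′)) (decode k)))
             (trans (cong₂ lab s t) (lab-sym (e′ , inj₂ (refl , refl)))) ⟩
      act (level e) (rot (voltage e)) (act (level e′) (rot (voltage e′)) (decode k))
        ≡⟨ cong (act (level e) (rot (voltage e))) (decode-ρ e′ k) ⟨
      act (level e) (rot (voltage e)) (decode (ρ e′ k))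
        ≡⟨ decode-ρ e (ρ e′ k) ⟨
      decode (ρ e (ρ e′ k)) ∎
      where open ≡-Reasoning
    antiparallel : ∀ e e′ k → src e ≡ tgt e′ → tgt e ≡ src e′ → ρ e (ρ e′ k) ≢ k
    antiparallel e e′ k s t eq
      with n , N≤n , r , fix ← act-separates (level e) (λ n → rot (voltage e) n ∘ rot (voltage e′) n) (λ n → id) (decode k)
             (trans (composite e e′ k s t) (trans (cong decode eq) (sym (act-id (level e) (decode k)))))
      = rot-free (voltage e′ + voltage e) n r (s≤s z≤n) (≤-trans (s≤s (+-mono-≤ (toℕ<n e′) (toℕ<n e))) N≤n)
          (trans (sym (rot-rot (voltage e) (voltage e′) n r)) fix)

  -- Copies of `S` and pieces inside the lift.

  inCopyOfS : Fin V → Fibre V N → Bool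
  inCopyOfS w (core _)    = S w
  inCopyOfS w (sat _ _ _) = false

  -- The `sat` sheets over `S` are counted as parts of the pieces; only the `core` sheets over `S`
  -- are to be removed.
  inPiece : Fin V → Fin N → Fin V → Fibre V N → Bool
  inPiece z i w (core i′)     = (not (S w) ∧ does (c w ≟ z)) ∧ does (i′ ≟ i)
  inPiece z i w (sat i′ j t) = does (j ≟ z) ∧ does (i′ ≟ i)

  inPiece-cycle : ∀ z i w i′ t → S w ≡ false → inPiece z i w (cycle i′ (c w) t) ≡ does (c w ≟ z) ∧ does (i′ ≟ i)
  inPiece-cycle z i w i′ zero    Sw rewrite Sw = refl
  inPiece-cycle z i w i′ (suc t) Sw = refl

  -- An edge meeting `S` starts on a `sat` sheet, since its cores involve a copy of `S`, and it
  -- stays in its block. An edge inside a class may pass between `core i` and the block of that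
  -- class, and both belong to the same piece.
  inPiece-edge : ∀ {u v} → Joins src tgt u v → ∀ g k z i →
    inCopyOfS u k ≡ false → inCopyOfS v (act (lab u v) g k) ≡ false →
    inPiece z i v (act (lab u v) g k) ≡ inPiece z i u k
  inPiece-edge {u} {v} joins g k z i p q with S u in Su | S v in Sv
  inPiece-edge joins g (sat i′ j t) z i p q | true | _ = refl
  inPiece-edge joins g (core i′) z i p q | true | _ = contradiction (trans (sym p) Su) λ ()
  inPiece-edge joins g (sat i′ j t) z i p q | false | true = refl
  inPiece-edge joins g (core i′) z i p q | false | true = contradiction (trans (sym q) Sv) λ ()
  inPiece-edge {u} {v} joins g (core i′) z i p q | false | false rewrite sep joins Su Sv | Su =
    inPiece-cycle z i v i′ (g (suc N) zero) Sv
  inPiece-edge {u} {v} joins g (sat i′ j t) z i p q | false | false rewrite sep joins Su Sv with j ≟ c v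
  ... | yes refl = inPiece-cycle z i v i′ (g (suc N) (suc t)) Sv
  ... | no _ = refl

  position : Fin (V * κ) → Fin V × Fibre V N
  position x = quotient {V} κ x , decode (remainder {V} κ x)

  position-combine : ∀ w k → position (combine w k) ≡ (w , decode k)
  position-combine w k = cong (λ p → proj₁ p , decode (proj₂ p)) (remQuot-combine {V} {κ} w k)

  piece : Fin V → Fin N → Fin (V * κ) → Bool
  piece z i x = inPiece z i (proj₁ (position x)) (proj₂ (position x))

  copyOfS : Fin (V * κ) → Bool
  copyOfS x = inCopyOfS (proj₁ (position x)) (proj₂ (position x))

  piece-edge : ∀ {x y} → Joins liftSrc liftTgt x y → copyOfS x ≡ false → copyOfS y ≡ false →
    ∀ z i → piece z i y ≡ piece z i x
  piece-edge (e , inj₂ (refl , refl)) p q z i = sym (piece-edge (e , inj₁ (refl , refl)) q p z i)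
  piece-edge (e , inj₁ (refl , refl)) p q z i = begin
    piece z i (liftTgt e)                 ≡⟨ cong (λ r → inPiece z i (proj₁ r) (proj₂ r)) atTgt ⟩
    inPiece z i w′ k′                     ≡⟨ inPiece-edge (ê , inj₁ (refl , refl)) (rot (voltage ê)) (decode (sheet e)) z i
      (trans (cong (λ r → inCopyOfS (proj₁ r) (proj₂ r)) (sym atSrc)) p)
      (trans (cong (λ r → inCopyOfS (proj₁ r) (proj₂ r)) (sym atTgt)) q) ⟩
    inPiece z i (src ê) (decode (sheet e)) ≡⟨ cong (λ r → inPiece z i (proj₁ r) (proj₂ r)) atSrc ⟨
    piece z i (liftSrc e)                 ∎
    where
    open ≡-Reasoning
    ê = edge e
    w′ = tgt ê
    k′ = act (level ê) (rot (voltage ê)) (decode (sheet e))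
    atSrc : position (liftSrc e) ≡ (src ê , decode (sheet e))
    atSrc = position-combine (src ê) (sheet e)
    atTgt : position (liftTgt e) ≡ (w′ , k′)
    atTgt = trans (position-combine w′ (ρ ê (sheet e))) (cong (w′ ,_) (decode-ρ ê (sheet e)))

  piece⇒¬copyOfS : ∀ z i x → piece z i x ≡ true → copyOfS x ≡ false
  piece⇒¬copyOfS z i x = go (quotient {V} κ x) (decode (remainder {V} κ x))
    where
    go : ∀ w k → inPiece z i w k ≡ true → inCopyOfS w k ≡ false
    go w (core i′) h with S w
    ... | false = refl
    go w (sat _ _ _) h = refl

  sum-lift : ∀ (f : Fin V → Fibre V N → ℕ) →
    sumFin (V * κ) (λ x → f (quotient {V} κ x) (decode (remainder {V} κ x))) ≡
    sumFin V (λ w → sumFin N (λ i → f w (core i)) + sumFin N (λ i → sumFin V (λ j → sumFin N (λ t → f w (sat i j t)))))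
  sum-lift f = trans (sum-combine V κ _) (sum-cong λ w →
    trans (sum-cong λ k → cong (λ p → f (proj₁ p) (decode (proj₂ p))) (remQuot-combine w k)) (sum-decode (f w)))

  #-copyOfS : # copyOfS ≡ N * # S
  #-copyOfS = trans (sum-lift (λ w k → ind (inCopyOfS w k) 1)) (trans (sum-cong pointwise) (sum-* V N _))
    where
    pointwise : ∀ w → sumFin N (λ _ → ind (S w) 1) + sumFin N (λ _ → sumFin V (λ _ → sumFin N (λ _ → 0))) ≡ N * ind (S w) 1
    pointwise w = trans (cong₂ _+_ (sum-const N (ind (S w) 1))
      (trans (sum-cong {N} λ _ → trans (sum-cong {V} λ _ → sum-zero N) (sum-zero V)) (sum-zero N))) (+-identityʳ _)

  -- The `sat` sheets contribute `N` over every vertex. As `V` is `nV A * 2`, the piece has the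
  -- parity of its class.
  #-piece : ∀ z i → # (piece z i) ≡ # (λ w → not (S w) ∧ does (c w ≟ z)) + V * N
  #-piece z i = trans (sum-lift (λ w k → ind (inPiece z i w k) 1)) (trans (sum-cong λ w → cong₂ _+_ (inCore w) inSat)
    (trans (sum-+ V _ _) (cong (# (λ w → not (S w) ∧ does (c w ≟ z)) +_) (sum-const V N))))
    where
    inCore : ∀ w → sumFin N (λ i′ → ind ((not (S w) ∧ does (c w ≟ z)) ∧ does (i′ ≟ i)) 1) ≡ ind (not (S w) ∧ does (c w ≟ z)) 1
    inCore w = trans (sum-cong λ i′ → sym (ind-ind (not (S w) ∧ does (c w ≟ z)) (does (i′ ≟ i)) 1))
      (trans (sum-ind N (not (S w) ∧ does (c w ≟ z)) (λ i′ → [ i′ ≟ i ])) (cong (ind (not (S w) ∧ does (c w ≟ z))) (sum-singleton i)))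
    inSat : sumFin N (λ i′ → sumFin V (λ j → sumFin N (λ t → ind (does (j ≟ z) ∧ does (i′ ≟ i)) 1))) ≡ N
    inSat = trans (sum-cong λ i′ → trans
        (sum-cong λ j → trans (sum-const N _) (trans (cong (N *_) (sym (ind-ind (does (j ≟ z)) _ 1))) (*-ind N (does (j ≟ z)) _)))
        (sum-δ′ z (λ _ → N * [ i′ ≟ i ])))
      (trans (sum-* N N (λ i′ → [ i′ ≟ i ])) (trans (cong (N *_) (sum-singleton i)) (*-identityʳ N)))

  pieces-disjoint : ∀ x → sumFin V (λ z → sumFin N (λ i → ind (piece z i x) 1)) ≤ 1
  pieces-disjoint x = go (quotient {V} κ x) (decode (remainder {V} κ x))
    where
    single : ∀ j i′ → sumFin V (λ z → sumFin N (λ i → ind (does (j ≟ z) ∧ does (i′ ≟ i)) 1)) ≡ 1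
    single j i′ = trans (sum-cong λ z → trans (sum-cong λ i → sym (ind-ind (does (j ≟ z)) (does (i′ ≟ i)) 1))
      (trans (sum-ind N (does (j ≟ z)) (λ i → [ i′ ≟ i ])) (cong (ind (does (j ≟ z))) (sum-δ i′ (λ _ → 1))))) (sum-δ j (λ _ → 1))
    go : ∀ w k → sumFin V (λ z → sumFin N (λ i → ind (inPiece z i w k) 1)) ≤ 1
    go w (sat i′ j t) = ≤-reflexive (single j i′)
    go w (core i′) with S w
    ... | true = ≤-trans (≤-reflexive (trans (sum-cong {V} λ _ → sum-zero N) (sum-zero V))) z≤n
    ... | false = ≤-reflexive (single (c w) i′)

  -- A perfect matching of the lift against the barrier.

  module _ (f : Fin (V * κ) → Fin (V * κ)) (inv : ∀ x → f (f x) ≡ x) (moved : ∀ x → f x ≢ x)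
           (joined : ∀ x → Joins liftSrc liftTgt x (f x)) where

    leaves : Fin V → Fin N → Fin (V * κ) → Bool
    leaves z i x = piece z i x ∧ copyOfS (f x)

    -- Otherwise the matching would restrict to the piece, because edges leave it only towards the
    -- copies of `S`; but an involution without fixed points needs an even set.
    odd-piece-leaves : ∀ z i → (∃ λ h → # (λ w → not (S w) ∧ does (c w ≟ z)) ≡ suc (h + h)) → 1 ≤ # (leaves z i)
    odd-piece-leaves z i (h , odd) with # (leaves z i) in none
    ... | suc _ = s≤s z≤n
    ... | zero = contradiction (begin
      2 * proj₁ even                             ≡⟨ cong (proj₁ even +_) (+-identityʳ _) ⟩
      proj₁ even + proj₁ even                    ≡⟨ cong (_+ (proj₁ even + proj₁ even)) unmoved ⟨
      # (λ x → stays x ∧ does (f x ≟ x)) + (proj₁ even + proj₁ even) ≡⟨ proj₂ even ⟨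
      # stays                                    ≡⟨ +-identityʳ _ ⟨
      # stays + 0                                ≡⟨ cong (# stays +_) none ⟨
      # stays + # (leaves z i)                   ≡⟨ sum-+ (V * κ) _ _ ⟨
      sumFin (V * κ) (λ x → ind (stays x) 1 + ind (leaves z i x) 1)
        ≡⟨ sum-cong (λ x → cases (piece z i x) (copyOfS (f x))) ⟩
      # (piece z i)                              ≡⟨ #-piece z i ⟩
      # (λ w → not (S w) ∧ does (c w ≟ z)) + V * N ≡⟨ cong₂ _+_ odd V*N ⟩
      suc (h + h + (nV A * N + nV A * N))        ≡⟨ cong suc (+-interchange h h _ _) ⟩
      suc (h + nV A * N + (h + nV A * N))        ≡⟨ cong (λ r → suc (h + nV A * N + r)) (+-identityʳ _) ⟨
      suc (2 * (h + nV A * N))                   ∎) (even≢odd (proj₁ even) (h + nV A * N))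
      where
      open ≡-Reasoning
      stays : Fin (V * κ) → Bool
      stays x = piece z i x ∧ not (copyOfS (f x))
      V*N : V * N ≡ nV A * N + nV A * N
      V*N = trans (*-assoc (nV A) 2 N) (trans (cong (λ r → nV A * (N + r)) (+-identityʳ N)) (*-distribˡ-+ (nV A) N N))
      cases : ∀ a b → ind (a ∧ not b) 1 + ind (a ∧ b) 1 ≡ ind a 1
      cases false b = refl
      cases true true = refl
      cases true false = refl
      ∧-true : ∀ {a b} → a ∧ b ≡ true → a ≡ true × b ≡ true
      ∧-true {true} {true} _ = refl , refl
      not-true : ∀ {b} → not b ≡ true → b ≡ false
      not-true {false} _ = refl
      step : ∀ x → stays x ≡ true → stays (f x) ≡ true
      step x h′ with p , q ← ∧-true {piece z i x} h′ with r ← piece⇒¬copyOfS z i x p =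
        cong₂ _∧_ (trans (piece-edge (joined x) r (not-true q) z i) p)
                  (cong not (trans (cong copyOfS (inv x)) r))
      even = #-parity f inv stays (λ x → bool-cong (λ e → subst (λ y → stays y ≡ true) (inv x) (step (f x) e)) (step x))
      unmoved : # (λ x → stays x ∧ does (f x ≟ x)) ≡ 0
      unmoved = trans (sum-cong λ x → cong (λ b → ind b 1)
        (trans (cong (stays x ∧_) (dec-false (f x ≟ x) (moved x))) (Bool.∧-zeroʳ (stays x)))) (sum-zero (V * κ))

    -- Each of the `N` pieces of a root sends a vertex into the copies of `S`. The pieces are
    -- disjoint and `f` is injective, so there are at most `N * # S` of them.
    few-roots : ∀ root → (∀ z → root z ≡ true → ∃ λ h → # (λ w → not (S w) ∧ does (c w ≟ z)) ≡ suc (h + h)) → # root ≤ # S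
    few-roots root odd = *-cancelˡ-≤ N (begin
      N * # root
        ≡⟨ trans (sum-cong λ z → sum-const N (ind (root z) 1)) (sum-* V N _) ⟨
      sumFin V (λ z → sumFin N (λ i → ind (root z) 1))
        ≤⟨ sum-mono (λ z → sum-mono λ i → bound z i) ⟩
      sumFin V (λ z → sumFin N (λ i → # (leaves z i)))
        ≡⟨ sum-cong {V} (λ z → sum-swap N (V * κ) (λ i x → ind (leaves z i x) 1)) ⟩
      sumFin V (λ z → sumFin (V * κ) (λ x → sumFin N (λ i → ind (leaves z i x) 1)))
        ≡⟨ sum-swap V (V * κ) _ ⟩
      sumFin (V * κ) (λ x → sumFin V (λ z → sumFin N (λ i → ind (leaves z i x) 1)))
        ≤⟨ sum-mono once ⟩
      # (copyOfS ∘ f)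
        ≡⟨ sum-bij f f inv inv (λ x → ind (copyOfS x) 1) ⟩
      # copyOfS
        ≡⟨ #-copyOfS ⟩
      N * # S ∎)
      where
      open ≤-Reasoning
      bound : ∀ z i → ind (root z) 1 ≤ # (leaves z i)
      bound z i with root z in rz
      ... | true = odd-piece-leaves z i (odd z rz)
      ... | false = z≤n
      once : ∀ x → sumFin V (λ z → sumFin N (λ i → ind (leaves z i x) 1)) ≤ ind (copyOfS (f x)) 1
      once x with copyOfS (f x)
      ... | true = ≤-trans (≤-reflexive (sum-cong λ z → sum-cong λ i → cong (λ b → ind b 1) (Bool.∧-identityʳ (piece z i x)))) (pieces-disjoint x)
      ... | false = ≤-reflexive (trans (sum-cong λ z → trans (sum-cong λ i → cong (λ b → ind b 1) (Bool.∧-zeroʳ (piece z i x))) (sum-zero N)) (sum-zero V))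
-- Perfect matchings

fin1 : (i : Fin 1) → i ≡ zero
fin1 zero = refl

mult-positive : (v a b : Fin n) → 1 ≤ mult v (nrm a b) → v ≡ a ⊎ v ≡ b
mult-positive v a b h with v ≟ a | v ≟ b
... | yes e | _ = inj₁ e
... | no _ | yes e = inj₂ e

mult-src : ∀ (v a b : Fin n) → v ≡ a → 1 ≤ mult v (nrm a b)
mult-src v a b e rewrite dec-true (v ≟ a) e = s≤s z≤n

mult-tgt : ∀ (v a b : Fin n) → v ≡ b → 1 ≤ mult v (nrm a b)
mult-tgt v a b e rewrite dec-true (v ≟ b) e = m≤n+m 1 _

PerfectMatching : (Fin n → Fin n → Set) → Set
PerfectMatching {n} R = ∃ λ (f : Fin n → Fin n) → (∀ x → f (f x) ≡ x) × (∀ x → f x ≢ x) × (∀ x → R x (f x))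

-- The edge `zero` of `F 1 1` is its semi-edge, of multiplicity 1, so exactly one edge above it ends
-- at each vertex.
cover⇒matching : ∀ G (s t : Fin (nE G) → Fin (nV G)) → (∀ e → ends G e ≡ nrm (s e) (t e)) →
  Covers G (F 1 1) → PerfectMatching (Joins s t)
cover⇒matching G s t normal (fV , fE , proj) = f , involutive , moved , λ x → e x , proj₂ (proj₂ (proj₂ (at x)))
  where
  module P = IsProjection proj
  weight : Fin (nV G) → Fin (nE G) → ℕ
  weight x e = ind (does (fE e ≟ zero)) (mult x (ends G e))
  total : ∀ x → sumFin (nE G) (weight x) ≡ 1
  total x = trans (P.local x zero) (cong (λ i → [ i ≟ zero ]) (fin1 (fV x)))
  at : ∀ x → ∃ λ e → fE e ≡ zero × ∃ λ y → (s e ≡ x × t e ≡ y) ⊎ (s e ≡ y × t e ≡ x)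
  at x with e , h ← sum-positive (weight x) (≤-reflexive (sym (total x)))
       with fe , k ← ind-positive (fE e ≟ zero) h
       with mult-positive x (s e) (t e) (≤-trans k (≤-reflexive (cong (mult x) (normal e))))
  ... | inj₁ p = e , fe , t e , inj₁ (sym p , refl)
  ... | inj₂ p = e , fe , s e , inj₂ (refl , sym p)
  e : Fin (nV G) → Fin (nE G)
  e x = proj₁ (at x)
  f : Fin (nV G) → Fin (nV G)
  f x = proj₁ (proj₂ (proj₂ (at x)))
  heavy : ∀ x a → fE a ≡ zero → x ≡ s a ⊎ x ≡ t a → 1 ≤ weight x a
  heavy x a fa h rewrite dec-true (fE a ≟ zero) fa | normal a =
    [ mult-src x (s a) (t a) , mult-tgt x (s a) (t a) ]′ h
  unique : ∀ x a b → fE a ≡ zero → fE b ≡ zero → x ≡ s a ⊎ x ≡ t a → x ≡ s b ⊎ x ≡ t b → a ≡ b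
  unique x a b fa fb ha hb = sum-unique (weight x) (≤-reflexive (total x)) a b (heavy x a fa ha) (heavy x b fb hb)
  loopless : ∀ a → s a ≢ t a
  loopless a = nrm-distinct G a (s a) (t a) (normal a)
  moved : ∀ x → f x ≢ x
  moved x fx with proj₂ (proj₂ (proj₂ (at x)))
  ... | inj₁ (p , q) = loopless (e x) (trans p (trans (sym fx) (sym q)))
  ... | inj₂ (p , q) = loopless (e x) (trans p (trans fx (sym q)))
  involutive : ∀ x → f (f x) ≡ x
  involutive x with at x
  ... | a , fa , y , ja with at y
  -- The edges chosen at `x` and at its partner `y` both end at `y`, hence coincide.
  ... | b , fb , z , jb with unique y a b fa fb ([ (λ { (_ , q) → inj₂ (sym q) }) , (λ { (p , _) → inj₁ (sym p) }) ]′ ja)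
                                              ([ (λ { (p , _) → inj₁ (sym p) }) , (λ { (_ , q) → inj₂ (sym q) }) ]′ jb)
  involutive x | a , fa , y , inj₁ (p , q) | a , fb , z , inj₁ (r , u) | refl = contradiction (trans r (sym q)) (loopless a)
  involutive x | a , fa , y , inj₁ (p , q) | a , fb , z , inj₂ (r , u) | refl = trans (sym r) p
  involutive x | a , fa , y , inj₂ (p , q) | a , fb , z , inj₁ (r , u) | refl = trans (sym u) q
  involutive x | a , fa , y , inj₂ (p , q) | a , fb , z , inj₂ (r , u) | refl = contradiction (trans p (sym u)) (loopless a)

-- From a perfect matching of the double to a semi-covering.

Ends-at : ∀ {n} (E : Ends n) → Fin (arity E) → Fin (n * 2) → Fin (n * 2) → Set
Ends-at E p x y = (doubleSrc E p ≡ x × doubleTgt E p ≡ y) ⊎ (doubleSrc E p ≡ y × doubleTgt E p ≡ x)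

-- A loop would match a vertex with itself; normal edges and semi-edges have a single end at `v`.
mult-matched : ∀ {n} (E : Ends n) p v y → (∀ a b → E ≡ nrm a b → a ≢ b) →
  Ends-at E p (combine v zero) y → y ≢ combine v zero → mult v E ≡ 1
mult-matched (nrm a b) p v y a≢b (inj₁ (q , r)) _ with refl , _ ← combine-injective a p v zero q =
  cong₂ _+_ ([]-yes (v ≟ v) refl) ([]-no (v ≟ b) (a≢b a b refl))
mult-matched (nrm a b) p v y a≢b (inj₂ (q , r)) _ with refl , _ ← combine-injective b p v zero r =
  cong₂ _+_ ([]-no (v ≟ a) (a≢b a b refl ∘ sym)) ([]-yes (v ≟ v) refl)
mult-matched (lp a) p v y _ (inj₁ (q , r)) y≢ = contradiction (trans (sym r) q) y≢
mult-matched (lp a) p v y _ (inj₂ (q , r)) y≢ = contradiction (trans (sym q) r) y≢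
mult-matched (sm a) p v y _ (inj₁ (q , r)) _ with refl , _ ← combine-injective a zero v zero q = []-yes (v ≟ v) refl
mult-matched (sm a) p v y _ (inj₂ (q , r)) _ with combine-injective a (suc zero) v zero r
... | _ , ()

-- A normal edge matched at copy `zero` has its other end in copy `zero` too, and a semi-edge has no
-- other vertex. So edges of `A` chosen at different vertices cannot clash.
incident-matched : ∀ {n} (E : Ends n) p (v v′ : Fin n) y → Ends-at E p (combine v′ zero) y → 1 ≤ mult v E →
  combine {n} {2} v zero ≡ combine v′ zero ⊎ combine {n} {2} v zero ≡ y
incident-matched (nrm a b) p v v′ y (inj₁ (q , r)) h with combine-injective a p v′ zero q | mult-positive v a b h
... | refl , refl | inj₁ refl = inj₁ refl
... | refl , refl | inj₂ refl = inj₂ r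
incident-matched (nrm a b) p v v′ y (inj₂ (q , r)) h with combine-injective b p v′ zero r | mult-positive v a b h
... | refl , refl | inj₁ refl = inj₂ q
... | refl , refl | inj₂ refl = inj₁ refl
incident-matched (lp a) p v v′ y j h with refl , _ ← ind-positive (v ≟ a) h with j
... | inj₁ (q , r) with refl , _ ← combine-injective v p v′ zero q = inj₁ refl
... | inj₂ (q , r) with refl , _ ← combine-injective v p v′ zero r = inj₁ refl
incident-matched (sm a) p v v′ y j h with refl , _ ← ind-positive (v ≟ a) h with j
... | inj₁ (q , r) = inj₁ q
... | inj₂ (q , r) with combine-injective v (suc zero) v′ zero r
... | _ , ()

module _ (A : Graph) (cubic : ∀ v → deg A v ≡ 3) where

  open Double A

  -- The matching is read off at copy `zero`. The chosen edges go to the semi-edge and all others to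
  -- the loop; a semi-edge that is not chosen is the reason for allowing `sl`.
  matching⇒semiCover : 0 < nV A → PerfectMatching (Joins src tgt) → SemiCovers A (F 1 1)
  matching⇒semiCover nonempty (f , inv , moved , joined) = fV , fE ,
    local⇒projection A (F 1 1) fV fE (λ { zero → fromℕ< nonempty , refl }) edges loc
    where
    -- Both ends of a matched pair select the same edge joining them.
    select : Fin (nV A * 2) → Fin ε
    select x = if does (toℕ x <? toℕ (f x)) then proj₁ (joined x) else proj₁ (joined (f x))
    select-sym : ∀ x → select (f x) ≡ select x
    select-sym x with <-cmp (toℕ x) (toℕ (f x))
    ... | tri< l _ ¬g = trans (cong₂ (λ b y → if b then proj₁ (joined (f x)) else proj₁ (joined y))
            (dec-false (_ <? _) (λ g → ¬g (subst (λ y → toℕ (f x) < toℕ y) (inv x) g))) (inv x))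
          (cong (λ b → if b then proj₁ (joined x) else proj₁ (joined (f x))) (sym (dec-true (_ <? _) l)))
    ... | tri> ¬l _ g = trans (cong (λ b → if b then proj₁ (joined (f x)) else proj₁ (joined (f (f x))))
            (dec-true (_ <? _) (subst (λ y → toℕ (f x) < toℕ y) (sym (inv x)) g)))
          (cong (λ b → if b then proj₁ (joined x) else proj₁ (joined (f x))) (sym (dec-false (_ <? _) ¬l)))
    ... | tri≈ _ e _ = contradiction (toℕ-injective (sym e)) (moved x)
    select-joins : ∀ x → (src (select x) ≡ x × tgt (select x) ≡ f x) ⊎ (src (select x) ≡ f x × tgt (select x) ≡ x)
    select-joins x with does (toℕ x <? toℕ (f x))
    ... | true = proj₂ (joined x)
    ... | false = [ (λ { (p , q) → inj₂ (p , trans q (inv x)) }) , (λ { (p , q) → inj₁ (trans p (inv x) , q) }) ]′ (proj₂ (joined (f x)))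
    chosen : Fin (nV A) → Fin (nE A)
    chosen v = base (select (combine v zero))
    chosen-mult : ∀ v → mult v (ends A (chosen v)) ≡ 1
    chosen-mult v = mult-matched (ends A (chosen v)) _ v (f (combine v zero))
      (λ a b → nrm-distinct A (chosen v) a b) (select-joins (combine v zero)) (moved _)
    chosen-unique : ∀ v v′ → 1 ≤ mult v (ends A (chosen v′)) → chosen v ≡ chosen v′
    chosen-unique v v′ h = [ cong (base ∘ select) , (λ e → trans (cong (base ∘ select) e) (cong base (select-sym _))) ]′
      (incident-matched (ends A (chosen v′)) _ v v′ (f (combine v′ zero)) (select-joins (combine v′ zero)) h)
    fV : Fin (nV A) → Fin 1
    fV _ = zero
    matched? : ∀ e → Dec (∃ λ v → chosen v ≡ e)
    matched? e = any? λ v → chosen v ≟ e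
    fE : Fin (nE A) → Fin 2
    fE e = if does (matched? e) then zero else suc zero
    edges : ∀ e → EdgeMap fV true (ends A e) (ends (F 1 1) (fE e))
    edges e with matched? e
    edges e | no _ with ends A e
    ... | nrm x y = nl refl refl
    ... | lp x    = ll refl
    ... | sm x    = sl refl
    edges e | yes (v , refl) with ends A (chosen v) | chosen-mult v
    ... | nrm x y | _ = ns refl refl
    ... | lp x    | h = contradiction h (double≢1 (does (v ≟ x)))
      where
      double≢1 : ∀ b → ind b 2 ≢ 1
      double≢1 true ()
      double≢1 false ()
    ... | sm x    | _ = ss refl
    matchedWeight : ∀ v e → ind (does (fE e ≟ zero)) (mult v (ends A e)) ≡ [ chosen v ≟ e ]
    matchedWeight v e with matched? e
    ... | no h = sym ([]-no (chosen v ≟ e) λ q → h (v , q))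
    ... | yes (v′ , refl) with chosen v ≟ chosen v′
    ... | yes q = subst (λ a → mult v (ends A a) ≡ 1) q (chosen-mult v)
    ... | no q with mult v (ends A (chosen v′)) in eq
    ... | zero = refl
    ... | suc _ = contradiction (chosen-unique v v′ (≤-trans (s≤s z≤n) (≤-reflexive (sym eq)))) q
    matchedDegree : ∀ v → sumFin (nE A) (λ e → ind (does (fE e ≟ zero)) (mult v (ends A e))) ≡ 1
    matchedDegree v = trans (sum-cong (matchedWeight v)) (sum-δ (chosen v) (λ _ → 1))
    partition : ∀ (i : Fin 2) k → ind (does (i ≟ zero)) k + ind (does (i ≟ suc zero)) k ≡ k
    partition zero       k = +-identityʳ k
    partition (suc zero) k = refl
    loc : ∀ v h → sumFin (nE A) (λ e → ind (does (fE e ≟ h)) (mult v (ends A e))) ≡ mult (fV v) (ends (F 1 1) h)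
    loc v zero = matchedDegree v
    -- Of the three edge-ends at `v` one lies over the semi-edge, which leaves two for the loop.
    loc v (suc zero) = suc-injective (begin
      suc (sumFin (nE A) (λ e → ind (does (fE e ≟ suc zero)) (mult v (ends A e))))
        ≡⟨ cong (_+ sumFin (nE A) (λ e → ind (does (fE e ≟ suc zero)) (mult v (ends A e)))) (matchedDegree v) ⟨
      sumFin (nE A) (λ e → ind (does (fE e ≟ zero)) (mult v (ends A e))) +
      sumFin (nE A) (λ e → ind (does (fE e ≟ suc zero)) (mult v (ends A e)))
        ≡⟨ sum-+ (nE A) _ _ ⟨
      sumFin (nE A) (λ e → ind (does (fE e ≟ zero)) (mult v (ends A e)) + ind (does (fE e ≟ suc zero)) (mult v (ends A e)))
        ≡⟨ sum-cong (λ e → partition (fE e) (mult v (ends A e))) ⟩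
      deg A v ≡⟨ cubic v ⟩
      3 ∎)
      where open ≡-Reasoning

-- One simple cover of `A` suffices to compare degrees. Taking all vertices as `S` makes `sep`
-- vacuous, and `BarrierLift` supplies such a cover.
▷⇒cubic : ∀ A → A ▷ F 1 1 → ∀ v → deg A v ≡ 3
▷⇒cubic A h v = cubicAt covers (h lift simple covers)
  where
  open BarrierLift A (λ _ → true) id (λ _ ())
  cubicAt : Covers lift A → Covers lift (F 1 1) → deg A v ≡ 3
  cubicAt (fV , _ , p) (gV , _ , q) with x , refl ← IsProjection.surjV p v =
    trans (sym (IsProjection.degPres p x)) (trans (IsProjection.degPres q x) (cong (deg (F 1 1)) (fin1 (gV x))))

theorem6 : (A : Graph) → Connected A → ((A ▷ F 1 1) ⇔ SemiCovers A (F 1 1))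
theorem6 A (nonempty , _) = mk⇔ forward (semiCovers⇒▷ A (F 1 1))
  where
  open Double A
  joins? : ∀ u v → Dec (Joins src tgt u v)
  joins? u v = any? λ e → ((src e ≟ u) ×-dec (tgt e ≟ v)) ⊎-dec ((src e ≟ v) ×-dec (tgt e ≟ u))
  joins-sym : ∀ {u v} → Joins src tgt u v → Joins src tgt v u
  joins-sym (e , inj₁ p) = e , inj₂ p
  joins-sym (e , inj₂ p) = e , inj₁ p
  forward : A ▷ F 1 1 → SemiCovers A (F 1 1)
  forward h with Tutte.tutte (Joins src tgt) joins? joins-sym
  ... | inj₁ matching = matching⇒semiCover A (▷⇒cubic A h) nonempty matching
  ... | inj₂ B = impossible (cover⇒matching lift liftSrc liftTgt (λ _ → refl) (h lift simple covers))
    where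
    module B = Barrier B
    open BarrierLift A B.S B.c B.sep
    impossible : PerfectMatching (Joins liftSrc liftTgt) → SemiCovers A (F 1 1)
    impossible (f , inv , moved , joined) =
      contradiction (few-roots f inv moved joined B.root B.odd) (<⇒≱ B.more)
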